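{- Let $\mathcal{P}$ be the set of integer partitions satisfying all of the following: (i) no part repeats; (ii) adjacent parts do not differ by $1$ if the larger of the two is even; (iii) for every integer $j$, none of $(2j)+(2j+1)+(2j+3)$, $(2j)+(2j+2)+(2j+3)$, $(2j)+(2j+2)+(2j+4)$ occurs as a sub-partition. Then, as formal power series in $x,q$, writing $N=i+2j+3k$, $$\sum_{\pi\in\mathcal{P}}x^{\ell(\pi)}q^{|\pi|}=\sum_{i,j,k\ge 0}(-1)^k\frac{x^{N}q^{N(N-1)+i+3j+3k^2+3k}}{(q;q)_i\,(q^4;q^4)_j\,(q^6;q^6)_k}.$$
   Context: Partitions are finite weakly increasing sequences of positive integers (the empty partition is included); $\ell(\pi)$ is the number of parts and $|\pi|$ the sum of the parts of $\pi$. A sub-partition of a partition is a contiguous portion of it. For $n\ge 0$, $(a;q)_n=\prod_{0\le t<n}(1-aq^t)$. All identities are identities of formal power series. -}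

module Defs where

open import Data.Bool.Base using (if_then_else_)
open import Data.Integer.Base as ℤ using (ℤ; +_; 0ℤ; 1ℤ; -1ℤ)
import Data.Integer.Properties as ℤ
open import Data.List.Base
  using (List; []; _∷_; map; foldr; applyUpTo; zipWith; length)
open import Data.List.Membership.Propositional using (_∈_)
open import Data.List.Relation.Binary.Infix.Heterogeneous using (Infix)
open import Data.List.Relation.Unary.All using (All)
open import Data.List.Relation.Unary.Linked using (Linked)
open import Data.List.Relation.Unary.Unique.Propositional using (Unique)
open import Data.Nat.Base using (ℕ; zero; suc; _+_; _*_; _∸_; _≤_; _>_)
open import Data.Nat.Divisibility using (_∣_)
open import Data.Nat.ListAction using (sum)
open import Data.Nat.Properties using (_≟_)
open import Data.Product.Base using (∃-syntax; _×_; _,_)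
open import Function.Base using (_∘_)
open import Relation.Binary.PropositionalEquality
  using (_≡_; _≢_; refl; cong; cong₂; trans; module ≡-Reasoning)
open import Relation.Nullary.Decidable.Core using (⌊_⌋)
open import Relation.Nullary.Negation.Core using (¬_)

∑ : List ℤ → ℤ
∑ = foldr ℤ._+_ 0ℤ

------------------------------------------------------------------------
-- Formal power series in q: a m is the coefficient of q^m.

QSeries : Set
QSeries = ℕ → ℤ

infix  9 q^_
infixr 8 _^_
infixr 7 _·_
infixl 7 _⊛_
infixl 6 _⊖_

q^_ : ℕ → QSeries
(q^ e) m = if ⌊ m ≟ e ⌋ then 1ℤ else 0ℤ

one : QSeries
one = q^ 0

_⊖_ : QSeries → QSeries → QSeries
(a ⊖ b) m = a m ℤ.- b m

_·_ : ℤ → QSeries → QSeries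
(c · a) m = c ℤ.* a m

_⊛_ : QSeries → QSeries → QSeries
(a ⊛ b) m = ∑ (applyUpTo (λ t → a t ℤ.* b (m ∸ t)) (suc m))

_^_ : QSeries → ℕ → QSeries
a ^ zero  = one
a ^ suc n = a ⊛ a ^ n

-- The multiplicative inverse of a series with constant coefficient 1 (a junk
-- value for any other series; see ⊛-recip).  recips a m lists the coefficients
-- of q^m, …, q^0 of the inverse, in this order.

nextRecip : QSeries → ℕ → List ℤ → ℤ
nextRecip a m bs = ℤ.- ∑ (zipWith ℤ._*_ (applyUpTo (a ∘ suc) (suc m)) bs)

recip : QSeries → QSeries
recips : QSeries → ℕ → List ℤ

recip a zero    = 1ℤ
recip a (suc m) = nextRecip a m (recips a m)

recips a zero    = 1ℤ ∷ []
recips a (suc m) = recip a (suc m) ∷ recips a m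

recips≡ : ∀ a m → recips a m ≡ applyUpTo (λ t → recip a (m ∸ t)) (suc m)
recips≡ a zero    = refl
recips≡ a (suc m) = cong (recip a (suc m) ∷_) (recips≡ a m)

zipWith-applyUpTo : ∀ (f g : ℕ → ℤ) n →
  zipWith ℤ._*_ (applyUpTo f n) (applyUpTo g n) ≡ applyUpTo (λ t → f t ℤ.* g t) n
zipWith-applyUpTo f g zero    = refl
zipWith-applyUpTo f g (suc n) =
  cong (f 0 ℤ.* g 0 ∷_) (zipWith-applyUpTo (f ∘ suc) (g ∘ suc) n)

⊛-recip : ∀ a → a 0 ≡ 1ℤ → ∀ m → (a ⊛ recip a) m ≡ one m
⊛-recip a a₀≡1 zero    rewrite a₀≡1 = refl
⊛-recip a a₀≡1 (suc m) = begin
  a 0 ℤ.* recip a (suc m) ℤ.+ s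
    ≡⟨ cong (λ c → c ℤ.* recip a (suc m) ℤ.+ s) a₀≡1 ⟩
  1ℤ ℤ.* recip a (suc m) ℤ.+ s
    ≡⟨ cong (ℤ._+ s) (ℤ.*-identityˡ (recip a (suc m))) ⟩
  recip a (suc m) ℤ.+ s
    ≡⟨ cong (λ bs → ℤ.- ∑ bs ℤ.+ s) zipped ⟩
  ℤ.- s ℤ.+ s
    ≡⟨ ℤ.+-inverseˡ s ⟩
  0ℤ ∎
  where
  open ≡-Reasoning
  b : QSeries
  b t = recip a (m ∸ t)
  s : ℤ
  s = ∑ (applyUpTo (λ t → a (suc t) ℤ.* b t) (suc m))
  zipped : zipWith ℤ._*_ (applyUpTo (a ∘ suc) (suc m)) (recips a m)
         ≡ applyUpTo (λ t → a (suc t) ℤ.* b t) (suc m)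
  zipped = trans (cong (zipWith ℤ._*_ (applyUpTo (a ∘ suc) (suc m))) (recips≡ a m))
                 (zipWith-applyUpTo (a ∘ suc) b (suc m))

-- poch a b n = (a ; b)_n = ∏_{0≤t<n} (1 - a b^t)

poch : QSeries → QSeries → ℕ → QSeries
poch a b n = foldr _⊛_ one (applyUpTo (λ t → one ⊖ a ⊛ b ^ t) n)

------------------------------------------------------------------------
-- Formal power series in x and q: F n m is the coefficient of x^n q^m.

Series : Set
Series = ℕ → QSeries

infix 6 x^_∙_

x^_∙_ : ℕ → QSeries → Series
(x^ N ∙ a) n m = if ⌊ n ≟ N ⌋ then a m else 0ℤ

-- F is the formal sum of the series f i over all i satisfying P: for every
-- monomial, only finitely many of these f i have a nonzero coefficient, and
-- these coefficients add up to that of F.  The list may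
-- contain indices with zero coefficient as well.

HasSum : {I : Set} → (I → Set) → (I → Series) → Series → Set
HasSum {I} P f F = ∀ n m → ∃[ is ]
    Unique is
  × All P is
  × (∀ i → P i → f i n m ≢ 0ℤ → i ∈ is)
  × F n m ≡ ∑ (map (λ i → f i n m) is)

------------------------------------------------------------------------
-- Partitions

record IsPartition (π : List ℕ) : Set where
  field
    positive   : All (_> 0) π
    increasing : Linked _≤_ π

-- σ is a contiguous portion (sub-partition) of π.

_OccursIn_ : List ℤ → List ℕ → Set
σ OccursIn π = Infix _≡_ σ (map +_ π)

record 𝒫 (π : List ℕ) : Set where
  field
    isPartition  : IsPartition π
    noRepeats    : Unique π
    -- parts increase, so in an adjacent pair the second is the larger
    evenGap      : Linked (λ a b → ¬ (b ≡ suc a × 2 ∣ b)) π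
    noForbidden₁ : ∀ (j : ℤ) → let d = + 2 ℤ.* j in
                   ¬ (d ∷ d ℤ.+ + 1 ∷ d ℤ.+ + 3 ∷ []) OccursIn π
    noForbidden₂ : ∀ (j : ℤ) → let d = + 2 ℤ.* j in
                   ¬ (d ∷ d ℤ.+ + 2 ∷ d ℤ.+ + 3 ∷ []) OccursIn π
    noForbidden₃ : ∀ (j : ℤ) → let d = + 2 ℤ.* j in
                   ¬ (d ∷ d ℤ.+ + 2 ∷ d ℤ.+ + 4 ∷ []) OccursIn π

------------------------------------------------------------------------
-- The summands of the two sides

weight : List ℕ → Series
weight π = x^ length π ∙ q^ (sum π)

-- For N = 0 the truncated N ∸ 1 is harmless, as it is multiplied by N.

term : ℕ × ℕ × ℕ → Series
term (i , j , k) =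
  x^ N ∙ (-1ℤ ℤ.^ k) · (q^ E ⊛ recip (poch (q^ 1) (q^ 1) i
                                     ⊛ poch (q^ 4) (q^ 4) j
                                     ⊛ poch (q^ 6) (q^ 6) k))
  where
  N E : ℕ
  N = i + 2 * j + 3 * k
  E = N * (N ∸ 1) + i + 3 * j + 3 * (k * k) + 3 * k

{-# OPTIONS --safe #-}
-- Write f_n for the coefficient of x^n in the generating function of 𝒫, and a_n
-- for the same coefficient when the part 1 is excluded.  Looking at the parts at
-- most 4 and subtracting an even number from the remaining parts gives
--   f_n = a_n + q^(2n-1) f_(n-1),
--   a_n = q^(2n) f_n + q^(4n-2) f_(n-1) + q^(4n-3) a_(n-2) + q^(6n-6) f_(n-2),
-- which determines both sequences.  On the other side, dividing the coefficient of
-- x^n in the triple sum by q^(n(n-1)) leaves that of the product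
--   G(x) = (x³q⁶;q⁶)_∞ / ((xq;q)_∞ (x²q³;q⁴)_∞),
-- and the two recurrences amount to H(x) = (1 - xq) G(x) and
--   (1 - x²q³) H(x) = (1 + xq² + x²q⁴) G(xq²),
-- which hold because (1 + xq² + x²q⁴) (1 - xq²) = 1 - x³q⁶.

module Submission where

open import Algebra.Bundles using (CommutativeRing)
import Algebra.Solver.Ring.NaturalCoefficients.Default as SemiringSolver
open import Data.Bool.Base using (true; false; if_then_else_)
open import Data.List.Base
  using (List; []; _∷_; _++_; map; foldr; applyUpTo; cartesianProduct; downFrom; length)
open import Data.Nat.Base as ℕ using (ℕ; zero; suc; _∸_; _≤_; _<_; z≤n; s≤s)
import Data.Nat.Properties as ℕ
open import Data.Product.Base using (∃-syntax; _×_; _,_; proj₁; proj₂)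
open import Data.Sum.Base as Sum using (_⊎_; inj₁; inj₂; [_,_]′)
open import Function.Base using (_∘_)
open import Relation.Binary.PropositionalEquality as ≡ using (_≡_)
open import Relation.Nullary.Decidable using (⌊_⌋; isYes≗does; from-no; yes; no)

-- The rules for 𝒫 look only at differences of nearby parts and at parity, so they survive
-- translation by an even number; every lower bound on the parts then reduces to 0 or 1, which is
-- why two sequences suffice. For n > 0 the recurrences return to f_n itself, so induction on n
-- would not close. Every return carries a positive power of q, and what determines the coefficients
-- is induction on the exponent of q. Dividing by q^(n(n-1)) removes the growth in n: a factor q^(cn
-- + const) in front of an entry of index n-d becomes q^((c-2d)n + const). In the second recurrence
-- the slopes c = 2, 4, 4, 6 with d = 0, 1, 2, 2 become 2, 2, 0, 2, and in the first one c = 2 with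
-- d = 1 becomes 0. Only slopes 0 and 2 remain, so x ↦ xq² is the only substitution in the resulting
-- equations. No infinite product is ever formed: its factors are represented by Euler's sums, and
-- only their functional equations and constant terms enter.

module FiniteSums {c ℓ} (R : CommutativeRing c ℓ) where

  open CommutativeRing R
  open import Relation.Binary.Reasoning.Setoid setoid

  ∑ : List Carrier → Carrier
  ∑ = foldr _+_ 0#

  ∑-cong : ∀ {I : Set} {f g : I → Carrier} → (∀ i → f i ≈ g i) →
           ∀ is → ∑ (map f is) ≈ ∑ (map g is)
  ∑-cong f≈g []       = refl
  ∑-cong f≈g (i ∷ is) = +-cong (f≈g i) (∑-cong f≈g is)

  *-distribˡ-∑ : ∀ {I : Set} c (f : I → Carrier) is →
                 c * ∑ (map f is) ≈ ∑ (map (λ i → c * f i) is)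
  *-distribˡ-∑ c f []       = zeroʳ c
  *-distribˡ-∑ c f (i ∷ is) = trans (distribˡ c _ _) (+-congˡ (*-distribˡ-∑ c f is))

  private
    ∑-pairs : ∀ {I J : Set} (f : I → Carrier) (g : J → Carrier) i js →
              f i * ∑ (map g js) ≈ ∑ (map (λ (i , j) → f i * g j) (map (i ,_) js))
    ∑-pairs f g i []       = zeroʳ (f i)
    ∑-pairs f g i (j ∷ js) = trans (distribˡ (f i) _ _) (+-congˡ (∑-pairs f g i js))

    map-++ : ∀ {I : Set} (f : I → Carrier) xs ys →
             ∑ (map f (xs ++ ys)) ≈ ∑ (map f xs) + ∑ (map f ys)
    map-++ f []       ys = sym (+-identityˡ _)
    map-++ f (x ∷ xs) ys = trans (+-congˡ (map-++ f xs ys)) (sym (+-assoc _ _ _))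

  ∑-*-∑ : ∀ {I J : Set} (f : I → Carrier) (g : J → Carrier) is js →
          ∑ (map f is) * ∑ (map g js) ≈
          ∑ (map (λ (i , j) → f i * g j) (cartesianProduct is js))
  ∑-*-∑ f g []       js = zeroˡ _
  ∑-*-∑ f g (i ∷ is) js = begin
    (f i + ∑ (map f is)) * ∑ (map g js)
      ≈⟨ distribʳ _ _ _ ⟩
    f i * ∑ (map g js) + ∑ (map f is) * ∑ (map g js)
      ≈⟨ +-cong (∑-pairs f g i js) (∑-*-∑ f g is js) ⟩
    ∑ (map h (map (i ,_) js)) + ∑ (map h (cartesianProduct is js))
      ≈⟨ map-++ h (map (i ,_) js) _ ⟨
    ∑ (map h (cartesianProduct (i ∷ is) js)) ∎
    where
    h = λ (i , j) → f i * g j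

-- The semiring solver knows no negation, so below n and u are separate variables
-- that stand for additive inverses.
module RingIdentities {c ℓ} (R : CommutativeRing c ℓ) where

  open CommutativeRing R
  open SemiringSolver commutativeSemiring
  open import Relation.Binary.Reasoning.Setoid setoid

  [1+n]*a+u*a≈a : ∀ {u n} → u + n ≈ 0# → ∀ a → (1# + n) * a + u * a ≈ a
  [1+n]*a+u*a≈a {u} {n} u+n≈0 a = begin
    (1# + n) * a + u * a
      ≈⟨ solve 3 (λ a u n → (con 1 :+ n) :* a :+ u :* a := a :+ (u :+ n) :* a) refl a u n ⟩
    a + (u + n) * a  ≈⟨ +-congˡ (trans (*-congʳ u+n≈0) (zeroˡ a)) ⟩
    a + 0#           ≈⟨ +-identityʳ a ⟩
    a                ∎

  -- With `n` the negative of `u`, this turns a functional equation F(x) = F(xq^e) + u F(x) into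
  -- F(xq^e) = (1 - u) F(x), which expresses a substituted factor by the original one.
  isolate : ∀ {u n a b} → u + n ≈ 0# → a ≈ b + u * a → b ≈ (1# + n) * a
  isolate {u} {n} {a} {b} u+n≈0 a≈b+ua = begin
    b                            ≈⟨ +-identityʳ b ⟨
    b + 0#                       ≈⟨ +-congˡ (trans (*-congʳ u+n≈0) (zeroˡ a)) ⟨
    b + (u + n) * a
      ≈⟨ solve 4 (λ a b u n → b :+ (u :+ n) :* a := (b :+ u :* a) :+ n :* a) refl a b u n ⟩
    (b + u * a) + n * a          ≈⟨ +-congʳ a≈b+ua ⟨
    a + n * a                    ≈⟨ solve 2 (λ a n → a :+ n :* a := (con 1 :+ n) :* a) refl a n ⟩
    (1# + n) * a                 ∎

  [1+y+y²]*[1+n]≈1+y²n : ∀ {y n} → y + n ≈ 0# →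
    (1# + (y + y * y)) * (1# + n) ≈ 1# + y * y * n
  [1+y+y²]*[1+n]≈1+y²n {y} {n} y+n≈0 = begin
    (1# + (y + y * y)) * (1# + n)
      ≈⟨ solve 2 (λ y n → (con 1 :+ (y :+ y :* y)) :* (con 1 :+ n)
           := (con 1 :+ y :* y :* n) :+ (con 1 :+ y) :* (y :+ n)) refl y n ⟩
    (1# + y * y * n) + (1# + y) * (y + n)  ≈⟨ +-congˡ (trans (*-congˡ y+n≈0) (zeroʳ (1# + y))) ⟩
    (1# + y * y * n) + 0#                  ≈⟨ +-identityʳ _ ⟩
    1# + y * y * n                         ∎

  -- Used with `p` = 1 - xq, `n` = -xq², `v` = x²q³, `y` = xq², and primes for x ↦ xq². Moving the
  -- factor `1# + n` from `c` over to `p * a` turns these into `c′` and `a′`, and leaves 1 + y + y²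
  -- behind. The variable `z` allows y² to be a single monomial in the conclusion.
  product-functional : ∀ {p n u v y z a b c a′ b′ c′ g′} →
    v + u ≈ 0# → y * y ≈ z →
    a′ ≈ (1# + n) * (p * a) → b′ ≈ (1# + u) * b →
    c ≈ (1# + (y + y * y)) * (1# + n) * c′ → g′ ≈ a′ * (b′ * c′) →
    p * (a * (b * c)) ≈ v * (p * (a * (b * c))) + (g′ + (y * g′ + z * g′))
  product-functional {p} {n} {u} {v} {y} {z} {a} {b} {c} {a′} {b′} {c′} {g′}
    v+u≈0 y²≈z a′≈ b′≈ c≈ g′≈ = begin
    h                              ≈⟨ [1+n]*a+u*a≈a v+u≈0 h ⟨
    (1# + u) * h + v * h           ≈⟨ +-comm _ _ ⟩
    v * h + (1# + u) * h
      ≈⟨ +-congˡ (*-congˡ (*-congˡ (*-congˡ (*-congˡ c≈)))) ⟩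
    v * h + (1# + u) * (p * (a * (b * (k * (1# + n) * c′))))
      ≈⟨ +-congˡ (solve 7 (λ u p a b k n c′ →
           (con 1 :+ u) :* (p :* (a :* (b :* (k :* (con 1 :+ n) :* c′)))) :=
           k :* (((con 1 :+ n) :* (p :* a)) :* (((con 1 :+ u) :* b) :* c′)))
           refl u p a b k n c′) ⟩
    v * h + k * (((1# + n) * (p * a)) * (((1# + u) * b) * c′))
      ≈⟨ +-congˡ (*-congˡ (trans g′≈ (*-cong a′≈ (*-congʳ b′≈)))) ⟨
    v * h + k * g′
      ≈⟨ +-congˡ (solve 3 (λ y z g → (con 1 :+ (y :+ z)) :* g := g :+ (y :* g :+ z :* g))
           refl y (y * y) g′) ⟩
    v * h + (g′ + (y * g′ + y * y * g′))
      ≈⟨ +-congˡ (+-congˡ (+-congˡ (*-congʳ y²≈z))) ⟩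
    v * h + (g′ + (y * g′ + z * g′)) ∎
    where
    h = p * (a * (b * c))
    k = 1# + (y + y * y)

  regroup : ∀ t a r b r′ c s r″ →
    t * (a * r * (b * r′ * (c * s * r″))) ≈ c * (t * a * b * s * (r * r′ * r″))
  regroup = solve 8 (λ t a r b r′ c s r″ →
    t :* (a :* r :* (b :* r′ :* (c :* s :* r″))) := c :* (t :* a :* b :* s :* (r :* r′ :* r″))) refl

-- Formal power series over a commutative ring

module PowerSeries {c ℓ} (R : CommutativeRing c ℓ) where

  open CommutativeRing R
  open FiniteSums R public using (∑)
  open SemiringSolver commutativeSemiring using (solve; _:=_; _:+_; _:*_; con)
  open import Relation.Binary.Reasoning.Setoid setoid

  PS : Set c
  PS = ℕ → Carrier

  infix  4 _≋_
  infixl 7 _⊛_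
  infixl 6 _⊕_
  infix  8 ⊝_

  _≋_ : PS → PS → Set ℓ
  a ≋ b = ∀ n → a n ≈ b n

  -- Over ℤ this product, and `mono e 1#` below, unfold to the product and to `q^ e` of the
  -- definitions, so the ring laws proved here hold for `QSeries` without any conversion.
  _⊛_ _⊕_ : PS → PS → PS
  (a ⊛ b) n = ∑ (applyUpTo (λ t → a t * b (n ∸ t)) (suc n))
  (a ⊕ b) n = a n + b n

  ⊝_ : PS → PS
  (⊝ a) n = - a n

  -- c x^e
  mono : ℕ → Carrier → PS
  mono e c n = if ⌊ n ℕ.≟ e ⌋ then c else 0#

  𝟘 𝟙 : PS
  𝟘 n = 0#
  𝟙   = mono 0 1#

  tail : PS → PS
  tail a = a ∘ suc

  scale : Carrier → PS → PS
  scale k a n = k * a n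

  -- Only the coefficients up to `n` enter that of degree `n`; `G-box` needs this to replace series
  -- by truncations that agree with them only up to that degree.
  ⊛-cong-≤ : ∀ {a a′ b b′} n → (∀ {t} → t ≤ n → a t ≈ a′ t) → (∀ {t} → t ≤ n → b t ≈ b′ t) →
             (a ⊛ b) n ≈ (a′ ⊛ b′) n
  ⊛-cong-≤ zero    p r = +-congʳ (*-cong (p z≤n) (r z≤n))
  ⊛-cong-≤ (suc n) p r =
    +-cong (*-cong (p z≤n) (r ℕ.≤-refl))
           (⊛-cong-≤ n (p ∘ s≤s) (r ∘ ℕ.m≤n⇒m≤1+n))

  ⊛-cong : ∀ {a a′ b b′} → a ≋ a′ → b ≋ b′ → a ⊛ b ≋ a′ ⊛ b′
  ⊛-cong p r n = ⊛-cong-≤ n (λ {t} _ → p t) (λ {t} _ → r t)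

  -- The product unfolds by splitting off the summand with `a 0`; commutativity needs the summand at
  -- the other end.
  ⊛-sucʳ : ∀ a b n → (a ⊛ b) (suc n) ≈ (a ⊛ tail b) n + a (suc n) * b 0
  ⊛-sucʳ a b zero    =
    solve 2 (λ x y → x :+ (y :+ con 0) := (x :+ con 0) :+ y) refl (a 0 * b 1) (a 1 * b 0)
  ⊛-sucʳ a b (suc n) = trans (+-congˡ (⊛-sucʳ (tail a) b n)) (sym (+-assoc _ _ _))

  ⊛-comm : ∀ a b → a ⊛ b ≋ b ⊛ a
  ⊛-comm a b zero    = +-congʳ (*-comm (a 0) (b 0))
  ⊛-comm a b (suc n) = begin
    a 0 * b (suc n) + (tail a ⊛ b) n  ≈⟨ +-cong (*-comm _ _) (⊛-comm (tail a) b n) ⟩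
    b (suc n) * a 0 + (b ⊛ tail a) n  ≈⟨ +-comm _ _ ⟩
    (b ⊛ tail a) n + b (suc n) * a 0  ≈⟨ ⊛-sucʳ b a n ⟨
    (b ⊛ a) (suc n)                   ∎

  ⊛-distribʳ : ∀ c a b → (a ⊕ b) ⊛ c ≋ a ⊛ c ⊕ b ⊛ c
  ⊛-distribʳ c a b zero =
    solve 3 (λ a b c → (a :+ b) :* c :+ con 0 := (a :* c :+ con 0) :+ (b :* c :+ con 0))
      refl (a 0) (b 0) (c 0)
  ⊛-distribʳ c a b (suc n) =
    trans (+-congˡ (⊛-distribʳ c (tail a) (tail b) n))
      (solve 5 (λ a b c x y → (a :+ b) :* c :+ (x :+ y) := (a :* c :+ x) :+ (b :* c :+ y))
        refl (a 0) (b 0) (c (suc n)) _ _)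

  scale-⊛ : ∀ k a b → scale k a ⊛ b ≋ scale k (a ⊛ b)
  scale-⊛ k a b zero =
    solve 3 (λ k a b → (k :* a) :* b :+ con 0 := k :* (a :* b :+ con 0)) refl k (a 0) (b 0)
  scale-⊛ k a b (suc n) =
    trans (+-congˡ (scale-⊛ k (tail a) b n))
      (solve 4 (λ k a b x → (k :* a) :* b :+ k :* x := k :* (a :* b :+ x))
        refl k (a 0) (b (suc n)) _)

  ⊛-assoc : ∀ a b c → (a ⊛ b) ⊛ c ≋ a ⊛ (b ⊛ c)
  ⊛-assoc a b c zero =
    solve 3 (λ a b c → (a :* b :+ con 0) :* c :+ con 0 := a :* (b :* c :+ con 0) :+ con 0)
      refl (a 0) (b 0) (c 0)
  ⊛-assoc a b c (suc n) = begin
    (a 0 * b 0 + 0#) * c (suc n) + (tail (a ⊛ b) ⊛ c) n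
      -- `tail (a ⊛ b)` unfolds to `scale (a 0) (tail b) ⊕ tail a ⊛ b`, which brings the induction
      -- down to `tail a`.
      ≈⟨ +-cong (*-congʳ (+-identityʳ _))
                (⊛-distribʳ c (scale (a 0) (tail b)) (tail a ⊛ b) n) ⟩
    a 0 * b 0 * c (suc n) + ((scale (a 0) (tail b) ⊛ c) n + ((tail a ⊛ b) ⊛ c) n)
      ≈⟨ +-congˡ (+-cong (scale-⊛ (a 0) (tail b) c n) (⊛-assoc (tail a) b c n)) ⟩
    a 0 * b 0 * c (suc n) + (a 0 * (tail b ⊛ c) n + (tail a ⊛ (b ⊛ c)) n)
      ≈⟨ solve 5 (λ a b c x y → a :* b :* c :+ (a :* x :+ y) := a :* (b :* c :+ x) :+ y)
           refl (a 0) (b 0) (c (suc n)) _ _ ⟩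
    (a ⊛ (b ⊛ c)) (suc n) ∎

  𝟘-⊛ : ∀ a → 𝟘 ⊛ a ≋ 𝟘
  𝟘-⊛ a zero    = trans (+-identityʳ _) (zeroˡ _)
  𝟘-⊛ a (suc n) = trans (+-cong (zeroˡ _) (𝟘-⊛ a n)) (+-identityʳ 0#)

  mono-suc : ∀ e c n → mono (suc e) c (suc n) ≡ mono e c n
  -- The two decisions are different terms, but their `does` fields agree by computation.
  mono-suc e c n = ≡.cong (λ t → if t then c else 0#)
    (≡.trans (isYes≗does (suc n ℕ.≟ suc e)) (≡.sym (isYes≗does (n ℕ.≟ e))))

  mono-suc-⊛ : ∀ e c a → tail (mono (suc e) c) ⊛ a ≋ mono e c ⊛ a
  mono-suc-⊛ e c a = ⊛-cong (λ n → reflexive (mono-suc e c n)) (λ n → refl)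

  mono-cong : ∀ {d e c c′} → d ≡ e → c ≈ c′ → mono d c ≋ mono e c′
  mono-cong {d} ≡.refl c≈c′ n with ⌊ n ℕ.≟ d ⌋
  ... | true  = c≈c′
  ... | false = refl

  mono-⊛-+ : ∀ e c a n → (mono e c ⊛ a) (e ℕ.+ n) ≈ c * a n
  mono-⊛-+ zero c a zero       = +-identityʳ _
  mono-⊛-+ zero c a (suc n)    = trans (+-congˡ (𝟘-⊛ a n)) (+-identityʳ _)
  mono-⊛-+ (suc e) c a n       =
    trans (+-cong (zeroˡ _) (trans (mono-suc-⊛ e c a (e ℕ.+ n)) (mono-⊛-+ e c a n))) (+-identityˡ _)

  mono-⊛-< : ∀ {e n} c a → n < e → (mono e c ⊛ a) n ≈ 0#
  mono-⊛-< {suc e} {zero}  c a _         = trans (+-identityʳ _) (zeroˡ _)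
  mono-⊛-< {suc e} {suc n} c a (s≤s n<e) =
    trans (+-cong (zeroˡ _) (trans (mono-suc-⊛ e c a n) (mono-⊛-< c a n<e))) (+-identityˡ _)

  ⊛-identityˡ : ∀ a → 𝟙 ⊛ a ≋ a
  ⊛-identityˡ a n = trans (mono-⊛-+ 0 1# a n) (*-identityˡ _)

  -- Allows the construction to be iterated: series in x have series in q as coefficients.
  commutativeRing : CommutativeRing c ℓ
  commutativeRing = record
    { Carrier = PS ; _≈_ = _≋_ ; _+_ = _⊕_ ; _*_ = _⊛_ ; -_ = ⊝_ ; 0# = 𝟘 ; 1# = 𝟙
    ; isCommutativeRing = record
      { isRing = record
        { +-isAbelianGroup = record
          { isGroup = record
            { isMonoid = record
              { isSemigroup = record
                { isMagma = record
                  { isEquivalence = record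
                    { refl = λ n → refl
                    ; sym = λ p n → sym (p n)
                    ; trans = λ p r n → trans (p n) (r n) }
                  ; ∙-cong = λ p r n → +-cong (p n) (r n) }
                ; assoc = λ a b c n → +-assoc (a n) (b n) (c n) }
              ; identity = (λ a n → +-identityˡ (a n)) , (λ a n → +-identityʳ (a n)) }
            ; inverse = (λ a n → -‿inverseˡ (a n)) , (λ a n → -‿inverseʳ (a n))
            ; ⁻¹-cong = λ p n → -‿cong (p n) }
          ; comm = λ a b n → +-comm (a n) (b n) }
        ; *-cong = ⊛-cong
        ; *-assoc = ⊛-assoc
        ; *-identity = ⊛-identityˡ , λ a n → trans (⊛-comm a 𝟙 n) (⊛-identityˡ a n)
        ; distrib = (λ a b c n → trans (⊛-comm a (b ⊕ c) n)
                      (trans (⊛-distribʳ a b c n) (+-cong (⊛-comm b a n) (⊛-comm c a n))))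
                  , ⊛-distribʳ }
      ; *-comm = ⊛-comm } }

  private
    module S = CommutativeRing commutativeRing
    module S∑ = FiniteSums commutativeRing

  ∑-at : ∀ {I : Set} (f : I → PS) is n → S∑.∑ (map f is) n ≡ ∑ (map (λ i → f i n) is)
  ∑-at f []       n = ≡.refl
  ∑-at f (i ∷ is) n = ≡.cong (f i n +_) (∑-at f is n)

  mono-< : ∀ {e n} c → n < e → mono e c n ≡ 0#
  mono-< {suc e} {zero}  c _         = ≡.refl
  mono-< {suc e} {suc n} c (s≤s n<e) = ≡.trans (mono-suc e c n) (mono-< c n<e)

  *-mono : (w : ℕ → Carrier) → ∀ e c n → w n * mono e c n ≈ mono e (w e * c) n
  *-mono w e c n with n ℕ.≟ e
  ... | yes ≡.refl = refl
  ... | no _       = zeroʳ (w n)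

  mono-⊛-mono : ∀ d e a b → mono d a ⊛ mono e b ≋ mono (d ℕ.+ e) (a * b)
  mono-⊛-mono zero    e a b n       =
    trans (mono-⊛-+ 0 a (mono e b) n) (*-mono (λ _ → a) e b n)
  mono-⊛-mono (suc d) e a b zero    = mono-⊛-< {suc d} a (mono e b) (s≤s z≤n)
  mono-⊛-mono (suc d) e a b (suc n) = begin
    (mono (suc d) a ⊛ mono e b) (suc n)  ≈⟨ +-congʳ (zeroˡ _) ⟩
    0# + (tail (mono (suc d) a) ⊛ mono e b) n
      ≈⟨ +-identityˡ _ ⟩
    (tail (mono (suc d) a) ⊛ mono e b) n ≈⟨ mono-suc-⊛ d a (mono e b) n ⟩
    (mono d a ⊛ mono e b) n              ≈⟨ mono-⊛-mono d e a b n ⟩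
    mono (d ℕ.+ e) (a * b) n             ≡⟨ mono-suc (d ℕ.+ e) (a * b) n ⟨
    mono (suc (d ℕ.+ e)) (a * b) (suc n) ∎

  mono-⊕ : ∀ e a b → mono e (a + b) ≋ mono e a ⊕ mono e b
  mono-⊕ e a b n with ⌊ n ℕ.≟ e ⌋
  ... | true  = refl
  ... | false = sym (+-identityʳ 0#)

  mono-inverse : ∀ e {a b} → a + b ≈ 0# → mono e a ⊕ mono e b ≋ 𝟘
  mono-inverse e a+b≈0 n with ⌊ n ℕ.≟ e ⌋
  ... | true  = a+b≈0
  ... | false = +-identityʳ 0#

  -- a(x^s), as a polynomial with K terms and as a series

  trunc : ℕ → (ℕ → Carrier) → ℕ → PS
  trunc s a K = S∑.∑ (map (λ j → mono (s ℕ.* j) (a j)) (downFrom K))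

  spread : ℕ → (ℕ → Carrier) → PS
  spread s a n = trunc s a (suc n) n

  spread-cong : ∀ s {a b} → (∀ j → a j ≈ b j) → spread s a ≋ spread s b
  spread-cong s a≈b n =
    S∑.∑-cong (λ j → mono-cong {s ℕ.* j} ≡.refl (a≈b j)) (downFrom (suc n)) n

  -- Since s ≥ 1, the terms with j > n have degree s j > n and cannot touch the coefficient of
  -- degree n.
  trunc≈spread : ∀ s .{{_ : ℕ.NonZero s}} a {n K} → n < K → trunc s a K n ≈ spread s a n
  trunc≈spread s a {n} {suc K} (s≤s n≤K) with ℕ.m≤n⇒m<n∨m≡n n≤K
  ... | inj₂ ≡.refl = refl
  ... | inj₁ n<K    =
    trans (+-cong (reflexive (mono-< (a K) (ℕ.<-≤-trans n<K (ℕ.m≤n*m K s))))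
                  (trunc≈spread s a n<K))
          (+-identityˡ _)

  module _ (s : ℕ) .{{_ : ℕ.NonZero s}} {a b c : ℕ → Carrier} (u : Carrier)
           (a₀≈b₀ : a 0 ≈ b 0) (recurrence : ∀ j → a (suc j) ≈ b (suc j) + u * c j) where

    trunc-recurrence : ∀ K →
      trunc s a (suc K) ≋ trunc s b (suc K) ⊕ mono s u ⊛ trunc s c K
    trunc-recurrence zero n = begin
      mono (s ℕ.* 0) (a 0) n + 0#
        ≈⟨ +-cong (mono-cong {s ℕ.* 0} ≡.refl a₀≈b₀ n) (sym (S.zeroʳ (mono s u) n)) ⟩
      mono (s ℕ.* 0) (b 0) n + (mono s u ⊛ 𝟘) n
        ≈⟨ +-congʳ (+-identityʳ _) ⟨
      mono (s ℕ.* 0) (b 0) n + 0# + (mono s u ⊛ 𝟘) n ∎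
    trunc-recurrence (suc K) n = begin
      mono e (a (suc K)) n + trunc s a (suc K) n
        ≈⟨ +-cong (S.trans (mono-cong {e} ≡.refl (recurrence K)) (mono-⊕ e _ _) n)
                  (trunc-recurrence K n) ⟩
      mono e (b (suc K)) n + mono e (u * c K) n
        + (trunc s b (suc K) n + (mono s u ⊛ trunc s c K) n)
        ≈⟨ +-congʳ (+-congˡ (S.trans (mono-⊛-mono s (s ℕ.* K) u (c K))
             (mono-cong (≡.sym (ℕ.*-suc s K)) refl) n)) ⟨
      mono e (b (suc K)) n + (mono s u ⊛ mono (s ℕ.* K) (c K)) n
        + (trunc s b (suc K) n + (mono s u ⊛ trunc s c K) n)
        ≈⟨ solve 4 (λ x y z t → (x :+ y) :+ (z :+ t) := (x :+ z) :+ (y :+ t)) refl _ _ _ _ ⟩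
      trunc s b (2 ℕ.+ K) n
        + ((mono s u ⊛ mono (s ℕ.* K) (c K)) n + (mono s u ⊛ trunc s c K) n)
        ≈⟨ +-congˡ (S.distribˡ (mono s u) (mono (s ℕ.* K) (c K)) (trunc s c K) n) ⟨
      trunc s b (2 ℕ.+ K) n + (mono s u ⊛ trunc s c (suc K)) n ∎
      where
      e = s ℕ.* suc K

    private
      -- `trunc-recurrence` at `n` leaves `c` with only `n` terms, one fewer than `spread` takes at
      -- degree n. The factor x^s lowers the degree to n - s < n, where `n` terms are enough.
      shift-trunc : ∀ n → (mono s u ⊛ trunc s c n) n ≈ (mono s u ⊛ spread s c) n
      shift-trunc n with n ℕ.<? s
      ... | yes n<s = trans (mono-⊛-< u (trunc s c n) n<s)
                          (sym (mono-⊛-< u (spread s c) n<s))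
      ... | no  n≮s with k , ≡.refl ← ℕ.m≤n⇒∃[o]m+o≡n (ℕ.≮⇒≥ n≮s) = begin
        (mono s u ⊛ trunc s c (s ℕ.+ k)) (s ℕ.+ k)
          ≈⟨ mono-⊛-+ s u (trunc s c (s ℕ.+ k)) k ⟩
        u * trunc s c (s ℕ.+ k) k
          ≈⟨ *-congˡ (trunc≈spread s c (ℕ.m<n+m k (ℕ.>-nonZero⁻¹ s))) ⟩
        u * spread s c k                            ≈⟨ mono-⊛-+ s u (spread s c) k ⟨
        (mono s u ⊛ spread s c) (s ℕ.+ k)           ∎

    -- The recurrence between coefficients becomes a(x^s) = b(x^s) + u x^s c(x^s), the common shape
    -- of the functional equations of the three factors.
    spread-recurrence : spread s a ≋ spread s b ⊕ mono s u ⊛ spread s c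
    spread-recurrence n = trans (trunc-recurrence n n) (+-congˡ (shift-trunc n))

  -- The substitution x ↦ w x, given the powers of w

  module Substitution (w : ℕ → Carrier) (w-0 : w 0 ≈ 1#)
                      (w-+ : ∀ m n → w (m ℕ.+ n) ≈ w m * w n) where

    twist : PS → PS
    twist a n = w n * a n

    private
      twist-tail : ∀ a → tail (twist a) ≋ scale (w 1) (twist (tail a))
      twist-tail a n = trans (*-congʳ (w-+ 1 n)) (*-assoc _ _ _)

    twist-⊛ : ∀ a b → twist (a ⊛ b) ≋ twist a ⊛ twist b
    twist-⊛ a b zero = begin
      w 0 * (a 0 * b 0 + 0#)          ≈⟨ *-cong w-0 (+-identityʳ _) ⟩
      1# * (a 0 * b 0)                ≈⟨ *-identityˡ _ ⟩
      a 0 * b 0                       ≈⟨ *-cong (twist-0 a) (twist-0 b) ⟨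
      w 0 * a 0 * (w 0 * b 0)         ≈⟨ +-identityʳ _ ⟨
      w 0 * a 0 * (w 0 * b 0) + 0#    ∎
      where
      twist-0 : ∀ a → w 0 * a 0 ≈ a 0
      twist-0 a = trans (*-congʳ w-0) (*-identityˡ _)
    twist-⊛ a b (suc n) = begin
      w (suc n) * (a 0 * b (suc n) + (tail a ⊛ b) n)
        ≈⟨ solve 4 (λ w a b x → w :* (a :* b :+ x) := a :* (w :* b) :+ w :* x) refl _ _ _ _ ⟩
      a 0 * (w (suc n) * b (suc n)) + w (suc n) * (tail a ⊛ b) n
        ≈⟨ +-cong (*-congʳ (sym (trans (*-congʳ w-0) (*-identityˡ _))))
                  (trans (*-congʳ (w-+ 1 n)) (*-assoc _ _ _)) ⟩
      w 0 * a 0 * twist b (suc n) + w 1 * twist (tail a ⊛ b) n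
        ≈⟨ +-congˡ (*-congˡ (twist-⊛ (tail a) b n)) ⟩
      w 0 * a 0 * twist b (suc n) + w 1 * (twist (tail a) ⊛ twist b) n
        ≈⟨ +-congˡ (trans (⊛-cong {b = twist b} (twist-tail a) (λ _ → refl) n)
                           (scale-⊛ (w 1) (twist (tail a)) (twist b) n)) ⟨
      (twist a ⊛ twist b) (suc n) ∎

    twist-cong : ∀ {a b} → a ≋ b → twist a ≋ twist b
    twist-cong a≈b n = *-congˡ (a≈b n)

    twist-⊕ : ∀ a b → twist (a ⊕ b) ≋ twist a ⊕ twist b
    twist-⊕ a b n = distribˡ (w n) (a n) (b n)

    twist-mono : ∀ e c → twist (mono e c) ≋ mono e (w e * c)
    twist-mono = *-mono w

    twist-trunc : ∀ s a K → twist (trunc s a K) ≋ trunc s (λ j → w (s ℕ.* j) * a j) K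
    twist-trunc s a zero    n = zeroʳ (w n)
    twist-trunc s a (suc K) n =
      trans (distribˡ (w n) _ _) (+-cong (*-mono w (s ℕ.* K) (a K) n) (twist-trunc s a K n))

    twist-spread : ∀ s a → twist (spread s a) ≋ spread s (λ j → w (s ℕ.* j) * a j)
    twist-spread s a n = twist-trunc s a (suc n) n

open import Defs
open import Data.Empty using (⊥-elim)
open import Data.Integer.Base as ℤ using (ℤ; 0ℤ; 1ℤ; -1ℤ)
import Data.Integer.Properties as ℤ
open import Data.List.Membership.Propositional using (_∈_)
open import Data.List.Membership.Propositional.Properties
  using (∈-map⁺; ∈-map⁻; ∈-++⁺ˡ; ∈-++⁺ʳ; ∈-++⁻; ∈-downFrom⁺; ∈-cartesianProduct⁺)
open import Data.List.Properties using (length-++; length-map; map-injective; ++-cancelˡ)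
open import Data.List.Relation.Binary.Infix.Heterogeneous using (here; there)
open import Data.List.Relation.Binary.Prefix.Heterogeneous using ([]; _∷_)
open import Data.List.Relation.Unary.All as All using (All; []; _∷_)
open import Data.List.Relation.Unary.AllPairs using ([]; _∷_)
open import Data.List.Relation.Unary.Any using (here)
open import Data.List.Relation.Unary.Linked as Linked using (Linked; []; [-]; _∷_)
open import Data.List.Relation.Unary.Unique.Propositional using (Unique)
import Data.List.Relation.Unary.Unique.Propositional.Properties as Unique
open import Data.Nat.Base using (_+_; _*_)
open import Data.Nat.Divisibility
  using (_∣_; _∣?_; divides; ∣m∣n⇒∣m+n; ∣m+n∣m⇒∣n)
open import Data.Nat.ListAction using (sum)
open import Data.Nat.ListAction.Properties using (sum-++)
open import Data.Nat.Solver using (module +-*-Solver)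
open import Data.Unit.Base using (⊤; tt)
open import Relation.Binary.PropositionalEquality
  using (_≢_; refl; sym; trans; cong; cong₂)
open import Relation.Nullary.Negation.Core using (¬_)
open import Relation.Unary using (U)

-- Series in q over ℤ, series in x over those, and reciprocals of q-Pochhammer symbols

module Q = PowerSeries ℤ.+-*-commutativeRing
module QR = CommutativeRing Q.commutativeRing
module X = PowerSeries Q.commutativeRing
module XR = CommutativeRing X.commutativeRing

module QReasoning where
  open import Relation.Binary.Reasoning.Setoid QR.setoid public
module QSolver = SemiringSolver QR.commutativeSemiring

infix 4 _≋_
_≋_ : QSeries → QSeries → Set
_≋_ = QR._≈_

q^-+ : ∀ d e → q^ d ⊛ q^ e ≋ q^ (d + e)
q^-+ d e = Q.mono-⊛-mono d e 1ℤ 1ℤ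

q^-cong : ∀ {d e} → d ≡ e → q^ d ≋ q^ e
q^-cong refl = QR.refl

q^-^ : ∀ e t → (q^ e) ^ t ≋ q^ (e * t)
q^-^ e zero    = q^-cong (sym (ℕ.*-zeroʳ e))
q^-^ e (suc t) = QR.trans (QR.*-congˡ {q^ e} (q^-^ e t))
  (QR.trans (q^-+ e (e * t)) (q^-cong (sym (ℕ.*-suc e t))))

∏-snoc : ∀ (f : ℕ → QSeries) n →
  foldr _⊛_ one (applyUpTo f (suc n)) ≋ foldr _⊛_ one (applyUpTo f n) ⊛ f n
∏-snoc f zero    = QR.*-comm (f 0) one
∏-snoc f (suc n) = QR.trans (QR.*-congˡ {f 0} (∏-snoc (f ∘ suc) n))
  (QR.sym (QR.*-assoc (f 0) (foldr _⊛_ one (applyUpTo (f ∘ suc) n)) (f (suc n))))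

∏-constant : ∀ (f : ℕ → QSeries) n → (∀ t → f t 0 ≡ 1ℤ) →
  foldr _⊛_ one (applyUpTo f n) 0 ≡ 1ℤ
∏-constant f zero    f₀ = refl
∏-constant f (suc n) f₀ =
  cong₂ (λ x y → x ℤ.* y ℤ.+ 0ℤ) (f₀ 0) (∏-constant (f ∘ suc) n (f₀ ∘ suc))

qpoch : ℕ → ℕ → QSeries
qpoch e = poch (q^ e) (q^ e)

qpoch-suc : ∀ e i → qpoch e (suc i) ≋ qpoch e i ⊛ (one ⊖ q^ (e * suc i))
qpoch-suc e i = QR.trans (∏-snoc (λ t → one ⊖ q^ e ⊛ (q^ e) ^ t) i)
  (QR.*-congˡ {qpoch e i} λ m → cong (λ z → one m ℤ.- z) (q^-^ e (suc i) m))

qpoch-constant : ∀ e .{{_ : ℕ.NonZero e}} i → qpoch e i 0 ≡ 1ℤ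
qpoch-constant (suc e) i = ∏-constant (λ t → one ⊖ q^ suc e ⊛ (q^ suc e) ^ t) i (λ t → refl)

rpoch : ℕ → ℕ → QSeries
rpoch e i = recip (qpoch e i)

recip-unique : ∀ a b → a 0 ≡ 1ℤ → a ⊛ b ≋ one → b ≋ recip a
recip-unique a b a₀ ab≈1 = begin
  b                   ≈⟨ QR.*-identityˡ b ⟨
  one ⊛ b             ≈⟨ QR.*-congʳ {b} (⊛-recip a a₀) ⟨
  a ⊛ recip a ⊛ b     ≈⟨ solve 3 (λ a b r → a :* r :* b := r :* (a :* b)) QR.refl a b (recip a) ⟩
  recip a ⊛ (a ⊛ b)   ≈⟨ QR.*-congˡ {recip a} ab≈1 ⟩
  recip a ⊛ one       ≈⟨ QR.*-identityʳ (recip a) ⟩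
  recip a             ∎
  where open QReasoning; open QSolver

recip-⊛ : ∀ a b → a 0 ≡ 1ℤ → b 0 ≡ 1ℤ → recip (a ⊛ b) ≋ recip a ⊛ recip b
recip-⊛ a b a₀ b₀ = QR.sym (recip-unique (a ⊛ b) (recip a ⊛ recip b)
  (cong₂ (λ x y → x ℤ.* y ℤ.+ 0ℤ) a₀ b₀) (begin
  a ⊛ b ⊛ (recip a ⊛ recip b)
    ≈⟨ solve 4 (λ a b r s → a :* b :* (r :* s) := (a :* r) :* (b :* s)) QR.refl
         a b (recip a) (recip b) ⟩
  (a ⊛ recip a) ⊛ (b ⊛ recip b)
    ≈⟨ QR.*-cong {a ⊛ recip a} {one} {b ⊛ recip b} {one} (⊛-recip a a₀) (⊛-recip b b₀) ⟩
  one ⊛ one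
    ≈⟨ QR.*-identityˡ one ⟩
  one ∎))
  where open QReasoning; open QSolver

-- This is (1 - q^(e(i+1))) / (q^e;q^e)_(i+1) = 1 / (q^e;q^e)_i, arranged without subtraction. The
-- power of q is the one that a substitution in x will produce.
rpoch-suc : ∀ e .{{_ : ℕ.NonZero e}} i →
  rpoch e (suc i) ≋ rpoch e i QR.+ q^ (e * suc i) ⊛ rpoch e (suc i)
rpoch-suc e i = begin
  r                          ≈⟨ QR.*-identityˡ r ⟨
  one ⊛ r                    ≈⟨ QR.*-congʳ {r} 1≈[1-c]+c ⟩
  ((one ⊖ c) QR.+ c) ⊛ r     ≈⟨ QR.distribʳ r (one ⊖ c) c ⟩
  (one ⊖ c) ⊛ r QR.+ c ⊛ r
    ≈⟨ QR.+-congʳ (recip-unique (qpoch e i) ((one ⊖ c) ⊛ r) (qpoch-constant e i) inverse) ⟩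
  rpoch e i QR.+ c ⊛ r       ∎
  where
  open QReasoning
  r = rpoch e (suc i)
  c = q^ (e * suc i)
  inverse : qpoch e i ⊛ ((one ⊖ c) ⊛ r) ≋ one
  inverse = begin
    qpoch e i ⊛ ((one ⊖ c) ⊛ r)  ≈⟨ QR.*-assoc (qpoch e i) (one ⊖ c) r ⟨
    qpoch e i ⊛ (one ⊖ c) ⊛ r    ≈⟨ QR.*-congʳ {r} (qpoch-suc e i) ⟨
    qpoch e (suc i) ⊛ r          ≈⟨ ⊛-recip (qpoch e (suc i)) (qpoch-constant e (suc i)) ⟩
    one                          ∎
  1≈[1-c]+c : one ≋ (one ⊖ c) QR.+ c
  1≈[1-c]+c m = sym (trans (ℤ.+-assoc (one m) (ℤ.- c m) (c m))
    (trans (cong (λ z → one m ℤ.+ z) (ℤ.+-inverseˡ (c m))) (ℤ.+-identityʳ (one m))))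

-- Euler's expansions of the three factors and their functional equations

α β γ : ℕ → QSeries
α i = q^ i ⊛ rpoch 1 i
β j = q^ (3 * j) ⊛ rpoch 4 j
-- Euler's expansion of (z;p)_∞ has coefficients (-1)^k p^(k(k-1)/2) / (p;p)_k; with p = q⁶ and z =
-- x³q⁶ the exponent of q is 3k(k-1) + 6k = 3k² + 3k.
γ k = Q.mono (3 * (k * k) + 3 * k) (-1ℤ ℤ.^ k) ⊛ rpoch 6 k

-- σ e F is F(x q^e)
module σ (e : ℕ) = X.Substitution (λ n → q^ (e * n))
  (q^-cong (ℕ.*-zeroʳ e))
  (λ m n → QR.trans (q^-cong (ℕ.*-distribˡ-+ e m n)) (QR.sym (q^-+ (e * m) (e * n))))
open σ using () renaming (twist to σ)

over-rpoch : ∀ (c : ℕ → QSeries) e .{{_ : ℕ.NonZero e}} j →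
  c (suc j) ⊛ rpoch e (suc j) ≋
  q^ (e * suc j) ⊛ (c (suc j) ⊛ rpoch e (suc j)) QR.+ c (suc j) ⊛ rpoch e j
over-rpoch c e j = begin
  d ⊛ r′                      ≈⟨ QR.*-congˡ {d} (rpoch-suc e j) ⟩
  d ⊛ (r QR.+ Q.mono (e * suc j) 1ℤ ⊛ r′)
    ≈⟨ solve 4 (λ d r x y → d :* (r :+ x :* y) := x :* (d :* y) :+ d :* r) QR.refl
         d r (q^ (e * suc j)) r′ ⟩
  q^ (e * suc j) ⊛ (d ⊛ r′) QR.+ d ⊛ r ∎
  where
  open QReasoning
  open QSolver
  d = c (suc j)
  r = rpoch e j
  r′ = rpoch e (suc j)

module _ (e s : ℕ) .{{_ : ℕ.NonZero s}} .{{_ : ℕ.NonZero (e * s)}}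
         (c c′ : ℕ → QSeries) (u : QSeries)
         (c-suc : ∀ j → c (suc j) ≋ u ⊛ c′ j) where

  private
    a a′ : ℕ → QSeries
    a  j = c j ⊛ rpoch (e * s) j
    a′ j = c′ j ⊛ rpoch (e * s) j

  -- The substitution x ↦ xq^e multiplies the coefficient of x^(sj) by q^(esj). Subtracting
  -- therefore cancels the last factor of (q^(es);q^(es))_j, and `c-suc` identifies what remains as
  -- u x^s times the series of `c′`.
  spread-functional : X.spread s a XR.≈ σ e (X.spread s a) XR.+ X.mono s u X.⊛ X.spread s a′
  spread-functional = XR.trans (X.spread-recurrence s {a} {b} {a′} u base step)
    (XR.+-congʳ (XR.sym (σ.twist-spread e s a)))
    where
    open QReasoning
    b : ℕ → QSeries
    b j = q^ (e * (s * j)) ⊛ a j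
    base : a 0 ≋ b 0
    base = QR.sym (QR.trans
      (QR.*-congʳ {a 0} (q^-cong (trans (cong (e *_) (ℕ.*-zeroʳ s)) (ℕ.*-zeroʳ e))))
      (QR.*-identityˡ (a 0)))
    step : ∀ j → a (suc j) ≋ b (suc j) QR.+ u ⊛ a′ j
    step j = begin
      a (suc j) ≈⟨ over-rpoch c (e * s) j ⟩
      q^ (e * s * suc j) ⊛ a (suc j) QR.+ c (suc j) ⊛ rpoch (e * s) j
        ≈⟨ QR.+-cong (QR.*-congʳ {a (suc j)} (q^-cong (ℕ.*-assoc e s (suc j))))
             (QR.trans (QR.*-congʳ {rpoch (e * s) j} (c-suc j))
                       (QR.*-assoc u (c′ j) (rpoch (e * s) j))) ⟩
      b (suc j) QR.+ u ⊛ a′ j ∎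

-- A = 1 / (xq;q)_∞, B = 1 / (x²q³;q⁴)_∞, C = (x³q⁶;q⁶)_∞, by Euler's expansions
A B C G H : Series
A = X.spread 1 α
B = X.spread 2 β
C = X.spread 3 γ
G = A X.⊛ (B X.⊛ C)

-- The bases q, q⁴, q⁶ must equal q^(es), where s = 1, 2, 3 is the step in x. This gives e = 1 here
-- and e = 2 for `B` and `C`; hence `A` alone needs its substitution twice to reach x ↦ xq².
A-functional : A XR.≈ σ 1 A XR.+ X.mono 1 (q^ 1) X.⊛ A
A-functional = spread-functional 1 1 q^_ q^_ (q^ 1) (λ j → QR.sym (q^-+ 1 j))

B-functional : B XR.≈ σ 2 B XR.+ X.mono 2 (q^ 3) X.⊛ B
B-functional = spread-functional 2 2 (λ j → q^ (3 * j)) (λ j → q^ (3 * j)) (q^ 3)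
  λ j → QR.sym (QR.trans (q^-+ 3 (3 * j)) (q^-cong (sym (ℕ.*-suc 3 j))))

C-functional : C XR.≈ σ 2 C XR.+ X.mono 3 (Q.mono 6 -1ℤ) X.⊛ σ 2 C
C-functional = XR.trans
  (spread-functional 2 3 c c′ (Q.mono 6 -1ℤ) c-suc)
  (XR.+-congˡ {σ 2 C} (XR.*-congˡ {X.mono 3 (Q.mono 6 -1ℤ)} (XR.trans
    (X.spread-cong 3 λ k → QR.*-assoc (q^ (2 * (3 * k))) (c k) (rpoch 6 k))
    (XR.sym (σ.twist-spread 2 3 γ)))))
  where
  open QReasoning
  c c′ : ℕ → QSeries
  c k = Q.mono (3 * (k * k) + 3 * k) (-1ℤ ℤ.^ k)
  -- From k to k + 1 the exponent 3k² + 3k grows by 6 + 6k: the 6 goes into `u`, and 6k = 2 (3k) is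
  -- the effect of x ↦ xq² on x^(3k), so the shifted series is `σ 2 C` instead of `C`.
  c′ k = q^ (2 * (3 * k)) ⊛ c k
  c-suc : ∀ k → c (suc k) ≋ Q.mono 6 -1ℤ ⊛ c′ k
  c-suc k = QR.sym (begin
    Q.mono 6 -1ℤ ⊛ (q^ (2 * (3 * k)) ⊛ c k)
      ≈⟨ QR.*-congˡ {Q.mono 6 -1ℤ}
           (Q.mono-⊛-mono (2 * (3 * k)) (3 * (k * k) + 3 * k) 1ℤ (-1ℤ ℤ.^ k)) ⟩
    Q.mono 6 -1ℤ ⊛ Q.mono (2 * (3 * k) + (3 * (k * k) + 3 * k)) (1ℤ ℤ.* (-1ℤ ℤ.^ k))
      ≈⟨ Q.mono-⊛-mono 6 (2 * (3 * k) + (3 * (k * k) + 3 * k)) -1ℤ (1ℤ ℤ.* (-1ℤ ℤ.^ k)) ⟩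
    Q.mono (6 + (2 * (3 * k) + (3 * (k * k) + 3 * k))) (-1ℤ ℤ.* (1ℤ ℤ.* (-1ℤ ℤ.^ k)))
      ≈⟨ Q.mono-cong (solve 1 (λ k →
           con 6 :+ (con 2 :* (con 3 :* k) :+ (con 3 :* (k :* k) :+ con 3 :* k)) :=
           con 3 :* ((con 1 :+ k) :* (con 1 :+ k)) :+ con 3 :* (con 1 :+ k)) refl k)
           (cong (-1ℤ ℤ.*_) (ℤ.*-identityˡ (-1ℤ ℤ.^ k))) ⟩
    c (suc k) ∎)
    where open +-*-Solver

module XI = RingIdentities X.commutativeRing
module XReasoning where
  open import Relation.Binary.Reasoning.Setoid XR.setoid public

-- c x^d q^e
xq : ℕ → ℕ → ℤ → Series
xq d e c = X.mono d (Q.mono e c)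

xq-inverse : ∀ d e → xq d e 1ℤ XR.+ xq d e -1ℤ XR.≈ XR.0#
xq-inverse d e = X.mono-inverse d (Q.mono-inverse e refl)

xq-* : ∀ d e a d′ e′ b → xq d e a X.⊛ xq d′ e′ b XR.≈ xq (d + d′) (e + e′) (a ℤ.* b)
xq-* d e a d′ e′ b = XR.trans (X.mono-⊛-mono d d′ (Q.mono e a) (Q.mono e′ b))
  (X.mono-cong {d + d′} refl (Q.mono-⊛-mono e e′ a b))

H = (XR.1# XR.+ xq 1 1 -1ℤ) X.⊛ G

G-decomposition : G XR.≈ H XR.+ xq 1 1 1ℤ X.⊛ G
G-decomposition = XR.sym (XI.[1+n]*a+u*a≈a {xq 1 1 1ℤ} {xq 1 1 -1ℤ} (xq-inverse 1 1) G)

σ₁A : σ 1 A XR.≈ (XR.1# XR.+ xq 1 1 -1ℤ) X.⊛ A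
σ₁A = XI.isolate {xq 1 1 1ℤ} {xq 1 1 -1ℤ} {A} {σ 1 A} (xq-inverse 1 1) A-functional

σ₂B : σ 2 B XR.≈ (XR.1# XR.+ xq 2 3 -1ℤ) X.⊛ B
σ₂B = XI.isolate {xq 2 3 1ℤ} {xq 2 3 -1ℤ} {B} {σ 2 B} (xq-inverse 2 3) B-functional

-- Substituting x ↦ xq in the functional equation of `A` gives A(xq) = A(xq²) + xq² A(xq).
σ₂A : σ 2 A XR.≈ (XR.1# XR.+ xq 1 2 -1ℤ) X.⊛ σ 1 A
σ₂A = XI.isolate {xq 1 2 1ℤ} {xq 1 2 -1ℤ} {σ 1 A} {σ 2 A} (xq-inverse 1 2) (begin
  σ 1 A
    ≈⟨ σ.twist-cong 1 A-functional ⟩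
  σ 1 (σ 1 A XR.+ xq 1 1 1ℤ X.⊛ A)
    ≈⟨ σ.twist-⊕ 1 (σ 1 A) (xq 1 1 1ℤ X.⊛ A) ⟩
  σ 1 (σ 1 A) XR.+ σ 1 (xq 1 1 1ℤ X.⊛ A)
    ≈⟨ XR.+-cong {σ 1 (σ 1 A)} {σ 2 A} σσ (XR.trans (σ.twist-⊛ 1 (xq 1 1 1ℤ) A)
         (XR.*-congʳ {σ 1 A} (XR.trans (σ.twist-mono 1 1 (q^ 1))
           (X.mono-cong {1} refl (q^-+ 1 1))))) ⟩
  σ 2 A XR.+ xq 1 2 1ℤ X.⊛ σ 1 A ∎)
  where
  open XReasoning
  σσ : σ 1 (σ 1 A) XR.≈ σ 2 A
  σσ n = QR.trans (QR.sym (QR.*-assoc (q^ (1 * n)) (q^ (1 * n)) (A n)))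
    (QR.*-congʳ {A n} (QR.trans (q^-+ (1 * n) (1 * n)) (q^-cong (+-lemma n))))
    where
    open +-*-Solver
    +-lemma = solve 1 (λ n → con 1 :* n :+ con 1 :* n := con 2 :* n) refl

-- Under x ↦ xq² the power x³ gains q⁶, so (x³q⁶;q⁶)_∞ loses its first factor 1 - x³q⁶. It is
-- written in factored form to expose the 1 - xq² that also occurs in `σ₂A`.
C-σ₂C : C XR.≈ (XR.1# XR.+ (xq 1 2 1ℤ XR.+ xq 1 2 1ℤ X.⊛ xq 1 2 1ℤ))
               X.⊛ (XR.1# XR.+ xq 1 2 -1ℤ) X.⊛ σ 2 C
C-σ₂C = begin
  C                                                  ≈⟨ C-functional ⟩
  σ 2 C XR.+ xq 3 6 -1ℤ X.⊛ σ 2 C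
    ≈⟨ XR.+-congʳ (XR.*-identityˡ (σ 2 C)) ⟨
  XR.1# X.⊛ σ 2 C XR.+ xq 3 6 -1ℤ X.⊛ σ 2 C
    ≈⟨ XR.distribʳ (σ 2 C) XR.1# (xq 3 6 -1ℤ) ⟨
  (XR.1# XR.+ xq 3 6 -1ℤ) X.⊛ σ 2 C
    ≈⟨ XR.*-congʳ {σ 2 C} (XR.+-congˡ {XR.1#} (XR.trans
         (XR.*-congʳ {xq 1 2 -1ℤ} (xq-* 1 2 1ℤ 1 2 1ℤ)) (xq-* 2 4 1ℤ 1 2 -1ℤ))) ⟨
  (XR.1# XR.+ y X.⊛ y X.⊛ xq 1 2 -1ℤ) X.⊛ σ 2 C
    ≈⟨ XR.*-congʳ {σ 2 C} (XI.[1+y+y²]*[1+n]≈1+y²n {y} {xq 1 2 -1ℤ} (xq-inverse 1 2)) ⟨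
  (XR.1# XR.+ (y XR.+ y X.⊛ y)) X.⊛ (XR.1# XR.+ xq 1 2 -1ℤ) X.⊛ σ 2 C ∎
  where
  open XReasoning
  y = xq 1 2 1ℤ

H-functional : H XR.≈ xq 2 3 1ℤ X.⊛ H XR.+
                      (σ 2 G XR.+ (xq 1 2 1ℤ X.⊛ σ 2 G XR.+ xq 2 4 1ℤ X.⊛ σ 2 G))
H-functional = XI.product-functional
  {XR.1# XR.+ xq 1 1 -1ℤ} {xq 1 2 -1ℤ} {xq 2 3 -1ℤ} {xq 2 3 1ℤ} {xq 1 2 1ℤ} {xq 2 4 1ℤ}
  {A} {B} {C} {σ 2 A} {σ 2 B} {σ 2 C} {σ 2 G}
  (xq-inverse 2 3) (xq-* 1 2 1ℤ 1 2 1ℤ)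
  (XR.trans σ₂A (XR.*-congˡ {XR.1# XR.+ xq 1 2 -1ℤ} σ₁A)) σ₂B C-σ₂C
  (XR.trans (σ.twist-⊛ 2 A (B X.⊛ C)) (XR.*-congˡ {σ 2 A} (σ.twist-⊛ 2 B C)))

-- From functional equations to recurrences for the coefficients

G-suc : ∀ n → G (suc n) ≋ H (suc n) QR.+ q^ 1 ⊛ G n
G-suc n = QR.trans (G-decomposition (suc n))
  (QR.+-congˡ {H (suc n)} (X.mono-⊛-+ 1 (q^ 1) G n))

H-zero : H 0 ≋ G 0
H-zero = QR.sym (QR.trans (G-decomposition 0)
  (QR.trans (QR.+-congˡ {H 0} (X.mono-⊛-< {1} (q^ 1) G (s≤s z≤n))) (QR.+-identityʳ (H 0))))

H-one : H 1 ≋ q^ (2 * 1) ⊛ G 1 QR.+ q^ 2 ⊛ (q^ (2 * 0) ⊛ G 0)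
H-one = begin
  H 1  ≈⟨ H-functional 1 ⟩
  (X.mono 2 (q^ 3) X.⊛ H) 1 QR.+ (σ 2 G 1 QR.+ (y 1 QR.+ z 1))
    ≈⟨ QR.+-cong {(X.mono 2 (q^ 3) X.⊛ H) 1} {QR.0#}
         {σ 2 G 1 QR.+ (y 1 QR.+ z 1)} {σ 2 G 1 QR.+ (q^ 2 ⊛ σ 2 G 0 QR.+ QR.0#)}
         (X.mono-⊛-< {2} (q^ 3) H (s≤s (s≤s z≤n)))
         (QR.+-congˡ {σ 2 G 1} (QR.+-cong {y 1} {q^ 2 ⊛ σ 2 G 0} {z 1} {QR.0#}
           (X.mono-⊛-+ 1 (q^ 2) (σ 2 G) 0)
           (X.mono-⊛-< {2} (q^ 4) (σ 2 G) (s≤s (s≤s z≤n))))) ⟩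
  QR.0# QR.+ (σ 2 G 1 QR.+ (q^ 2 ⊛ σ 2 G 0 QR.+ QR.0#))
    ≈⟨ QR.+-identityˡ (σ 2 G 1 QR.+ (q^ 2 ⊛ σ 2 G 0 QR.+ QR.0#)) ⟩
  σ 2 G 1 QR.+ (q^ 2 ⊛ σ 2 G 0 QR.+ QR.0#)
    ≈⟨ QR.+-congˡ {σ 2 G 1} (QR.+-identityʳ (q^ 2 ⊛ σ 2 G 0)) ⟩
  σ 2 G 1 QR.+ q^ 2 ⊛ σ 2 G 0  ∎
  where
  open QReasoning
  y = X.mono 1 (q^ 2) X.⊛ σ 2 G
  z = X.mono 2 (q^ 4) X.⊛ σ 2 G

H-suc² : ∀ n → H (2 + n) ≋ q^ 3 ⊛ H n QR.+ (q^ (2 * (2 + n)) ⊛ G (2 + n) QR.+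
  (q^ 2 ⊛ (q^ (2 * (1 + n)) ⊛ G (1 + n)) QR.+ q^ 4 ⊛ (q^ (2 * n) ⊛ G n)))
H-suc² n = QR.trans (H-functional (2 + n))
  (QR.+-cong {(X.mono 2 (q^ 3) X.⊛ H) (2 + n)} {q^ 3 ⊛ H n}
    {σ 2 G (2 + n) QR.+ (y (2 + n) QR.+ z (2 + n))}
    {σ 2 G (2 + n) QR.+ (q^ 2 ⊛ σ 2 G (1 + n) QR.+ q^ 4 ⊛ σ 2 G n)}
    (X.mono-⊛-+ 2 (q^ 3) H n) (QR.+-congˡ {σ 2 G (2 + n)}
    (QR.+-cong {y (2 + n)} {q^ 2 ⊛ σ 2 G (1 + n)} {z (2 + n)} {q^ 4 ⊛ σ 2 G n}
      (X.mono-⊛-+ 1 (q^ 2) (σ 2 G) (suc n)) (X.mono-⊛-+ 2 (q^ 4) (σ 2 G) n))))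
  where
  y = X.mono 1 (q^ 2) X.⊛ σ 2 G
  z = X.mono 2 (q^ 4) X.⊛ σ 2 G

rpoch-zero : ∀ e → rpoch e 0 ≋ one
rpoch-zero e = QR.sym (recip-unique one one refl (QR.*-identityˡ one))

spread-zero : ∀ s a → a 0 ≋ one → X.spread s a 0 ≋ one
spread-zero s a a₀ = QR.trans (QR.+-identityʳ (X.mono (s * 0) (a 0) 0))
  (QR.trans (X.mono-cong {s * 0} (ℕ.*-zeroʳ s) (QR.refl {a 0}) 0) a₀)

G-zero : G 0 ≋ one
G-zero = begin
  A 0 ⊛ (B 0 ⊛ C 0 QR.+ QR.0#) QR.+ QR.0#  ≈⟨ QR.+-identityʳ _ ⟩
  A 0 ⊛ (B 0 ⊛ C 0 QR.+ QR.0#)             ≈⟨ QR.*-congˡ {A 0} (QR.+-identityʳ (B 0 ⊛ C 0)) ⟩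
  A 0 ⊛ (B 0 ⊛ C 0)
    ≈⟨ QR.*-cong {A 0} {one} {B 0 ⊛ C 0} {one ⊛ one}
         (spread-zero 1 α (κ≈1 1)) (QR.*-cong {B 0} {one} {C 0} {one}
         (spread-zero 2 β (κ≈1 4)) (spread-zero 3 γ (κ≈1 6))) ⟩
  one ⊛ (one ⊛ one)                        ≈⟨ QR.*-identityˡ (one ⊛ one) ⟩
  one ⊛ one                                ≈⟨ QR.*-identityˡ one ⟩
  one                                      ∎
  where
  open QReasoning
  κ≈1 : ∀ e → one ⊛ rpoch e 0 ≋ one
  κ≈1 e = QR.trans (QR.*-identityˡ (rpoch e 0)) (rpoch-zero e)

tri : ℕ → ℕ
tri n = n * (n ∸ 1)

tri-suc : ∀ n → tri (suc n) ≡ 2 * n + tri n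
tri-suc zero    = refl
tri-suc (suc n) = solve 1 (λ n → (con 2 :+ n) :* (con 1 :+ n) :=
  con 2 :* (con 1 :+ n) :+ (con 1 :+ n) :* n) refl n
  where open +-*-Solver

-- f will count 𝒫, and a the partitions in 𝒫 without the part 1
f a : Series
f n = q^ tri n ⊛ G n
a n = q^ tri n ⊛ H n

f-zero : f 0 ≋ one
f-zero = QR.trans (QR.*-identityˡ (G 0)) G-zero

a-zero : a 0 ≋ one
a-zero = QR.trans (QR.*-identityˡ (H 0)) (QR.trans H-zero G-zero)

q^-⊛ : ∀ d e b → q^ d ⊛ (q^ e ⊛ b) ≋ q^ (d + e) ⊛ b
q^-⊛ d e b = QR.trans (QR.sym (QR.*-assoc (q^ d) (q^ e) b)) (QR.*-congʳ {b} (q^-+ d e))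

q^-exchange : ∀ {d e d′ e′} b → d + e ≡ d′ + e′ → q^ d ⊛ (q^ e ⊛ b) ≋ q^ d′ ⊛ (q^ e′ ⊛ b)
q^-exchange {d} {e} {d′} {e′} b eq = QR.trans (q^-⊛ d e b)
  (QR.trans (QR.*-congʳ {b} (q^-cong eq)) (QR.sym (q^-⊛ d′ e′ b)))

q^-exchange₂ : ∀ {d e e₂ d′ e′} b → d + (e + e₂) ≡ d′ + e′ →
  q^ d ⊛ (q^ e ⊛ (q^ e₂ ⊛ b)) ≋ q^ d′ ⊛ (q^ e′ ⊛ b)
q^-exchange₂ {d} {e} {e₂} {d′} {e′} b eq =
  QR.trans (QR.*-congˡ {q^ d} (q^-⊛ e e₂ b)) (q^-exchange {d} {e + e₂} {d′} {e′} b eq)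

f-suc : ∀ n → f (suc n) ≋ q^ (1 + 2 * n) ⊛ f n QR.+ a (suc n)
f-suc n = begin
  q^ tri (suc n) ⊛ G (suc n)      ≈⟨ QR.*-congˡ {q^ tri (suc n)} (G-suc n) ⟩
  q^ tri (suc n) ⊛ (H (suc n) QR.+ q^ 1 ⊛ G n)
    ≈⟨ QR.distribˡ (q^ tri (suc n)) (H (suc n)) (q^ 1 ⊛ G n) ⟩
  a (suc n) QR.+ q^ tri (suc n) ⊛ (q^ 1 ⊛ G n)
    ≈⟨ QR.+-congˡ {a (suc n)} (q^-exchange {tri (suc n)} {1} {1 + 2 * n} {tri n} (G n)
         (trans (cong (_+ 1) (tri-suc n)) (ℕ.+-comm (2 * n + tri n) 1))) ⟩
  a (suc n) QR.+ q^ (1 + 2 * n) ⊛ f n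
    ≈⟨ QR.+-comm (a (suc n)) (q^ (1 + 2 * n) ⊛ f n) ⟩
  q^ (1 + 2 * n) ⊛ f n QR.+ a (suc n) ∎
  where open QReasoning

-- The exponents are left in the form sum ρ + s * n in which count-▸ yields them.
a-one : a 1 ≋ q^ (0 + 2 * 1) ⊛ f 1 QR.+ q^ (2 + 4 * 0) ⊛ f 0
a-one = begin
  one ⊛ H 1  ≈⟨ QR.*-congˡ {one} H-one ⟩
  one ⊛ (q^ 2 ⊛ G 1 QR.+ q^ 2 ⊛ (one ⊛ G 0))
    ≈⟨ QR.distribˡ one (q^ 2 ⊛ G 1) (q^ 2 ⊛ (one ⊛ G 0)) ⟩
  one ⊛ (q^ 2 ⊛ G 1) QR.+ one ⊛ (q^ 2 ⊛ (one ⊛ G 0))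
    ≈⟨ QR.+-cong (q^-exchange {0} {2} {2} {0} (G 1) refl)
               (q^-exchange₂ {0} {2} {0} {2} {0} (G 0) refl) ⟩
  q^ 2 ⊛ f 1 QR.+ q^ 2 ⊛ f 0 ∎
  where open QReasoning

-- Since tri(n+2) exceeds tri(n+1) by 2n + 2 and tri(n) by 4n + 2, the exponents left over are
-- (2n+2) + 2 + (2n+2) for `f (1 + n)`, (4n+2) + 3 for `a n`, and (4n+2) + 4 + 2n for `f n`.
a-suc² : ∀ n → a (2 + n) ≋
  q^ (0 + 2 * (2 + n)) ⊛ f (2 + n) QR.+ (q^ (2 + 4 * (1 + n)) ⊛ f (1 + n) QR.+
  (q^ (5 + 4 * n) ⊛ a n QR.+ q^ (6 + 6 * n) ⊛ f n))
a-suc² n = begin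
  t ⊛ H (2 + n)  ≈⟨ QR.*-congˡ {t} (H-suc² n) ⟩
  t ⊛ (h₀ QR.+ (g₂ QR.+ (g₁ QR.+ g₀)))
    ≈⟨ solve 5 (λ t h₀ g₂ g₁ g₀ → t :* (h₀ :+ (g₂ :+ (g₁ :+ g₀))) :=
         t :* g₂ :+ (t :* g₁ :+ (t :* h₀ :+ t :* g₀))) QR.refl t h₀ g₂ g₁ g₀ ⟩
  t ⊛ g₂ QR.+ (t ⊛ g₁ QR.+ (t ⊛ h₀ QR.+ t ⊛ g₀))
    ≈⟨ QR.+-cong (q^-exchange {tri (2 + n)} {2 * (2 + n)} {2 * (2 + n)} {tri (2 + n)} (G (2 + n))
        (ℕ.+-comm (tri (2 + n)) _))
      (QR.+-cong (q^-exchange₂ {tri (2 + n)} {2} {2 * (1 + n)} {2 + 4 * (1 + n)} {tri (1 + n)}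
        (G (1 + n)) (e₁ (tri (1 + n)) (tri-suc (1 + n))))
      (QR.+-cong (q^-exchange {tri (2 + n)} {3} {5 + 4 * n} {tri n} (H n) (e₂ (tri n) tri-suc²))
                 (q^-exchange₂ {tri (2 + n)} {4} {2 * n} {6 + 6 * n} {tri n}
        (G n) (e₃ (tri n) tri-suc²)))) ⟩
  q^ (0 + 2 * (2 + n)) ⊛ f (2 + n) QR.+ (q^ (2 + 4 * (1 + n)) ⊛ f (1 + n) QR.+
  (q^ (5 + 4 * n) ⊛ a n QR.+ q^ (6 + 6 * n) ⊛ f n)) ∎
  where
  open QReasoning
  open QSolver
  t h₀ g₂ g₁ g₀ : QSeries
  t  = q^ tri (2 + n)
  h₀ = q^ 3 ⊛ H n
  g₂ = q^ (2 * (2 + n)) ⊛ G (2 + n)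
  g₁ = q^ 2 ⊛ (q^ (2 * (1 + n)) ⊛ G (1 + n))
  g₀ = q^ 4 ⊛ (q^ (2 * n) ⊛ G n)
  tri-suc² : tri (2 + n) ≡ 2 * (1 + n) + (2 * n + tri n)
  tri-suc² = trans (tri-suc (1 + n)) (cong (2 * (1 + n) +_) (tri-suc n))
  module N = +-*-Solver
  -- `tri` involves truncated subtraction, so it is passed to the semiring solver as an opaque `z`.
  e₁ : ∀ z {u} → u ≡ 2 * (1 + n) + z → u + (2 + 2 * (1 + n)) ≡ 2 + 4 * (1 + n) + z
  e₁ z refl = N.solve 2 (λ n z → let m = N.con 2 N.:* (N.con 1 N.:+ n) in
    (m N.:+ z) N.:+ (N.con 2 N.:+ m) N.:= (N.con 2 N.:+ N.con 4 N.:* (N.con 1 N.:+ n)) N.:+ z)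
    refl n z
  e₂ : ∀ z {u} → u ≡ 2 * (1 + n) + (2 * n + z) → u + 3 ≡ 5 + 4 * n + z
  e₂ z refl = N.solve 2 (λ n z →
    (N.con 2 N.:* (N.con 1 N.:+ n) N.:+ (N.con 2 N.:* n N.:+ z)) N.:+ N.con 3
      N.:= (N.con 5 N.:+ N.con 4 N.:* n) N.:+ z) refl n z
  e₃ : ∀ z {u} → u ≡ 2 * (1 + n) + (2 * n + z) → u + (4 + 2 * n) ≡ 6 + 6 * n + z
  e₃ z refl = N.solve 2 (λ n z →
    (N.con 2 N.:* (N.con 1 N.:+ n) N.:+ (N.con 2 N.:* n N.:+ z)) N.:+ (N.con 4 N.:+ N.con 2 N.:* n)
      N.:= (N.con 6 N.:+ N.con 6 N.:* n) N.:+ z) refl n z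

-- Expanding the product into the triple sum

module QI = RingIdentities Q.commutativeRing
module Q∑ = FiniteSums Q.commutativeRing
module X∑ = FiniteSums X.commutativeRing

Triple : Set
Triple = ℕ × ℕ × ℕ

total : Triple → ℕ
total (i , j , k) = i + 2 * j + 3 * k

box : ℕ → List Triple
box K = cartesianProduct (downFrom K) (cartesianProduct (downFrom K) (downFrom K))

x^-cong : ∀ N {b c} → b ≋ c → ∀ n m → (x^ N ∙ b) n m ≡ (x^ N ∙ c) n m
x^-cong N b≋c n m with ⌊ n ℕ.≟ N ⌋
... | true  = b≋c m
... | false = refl

mono≡x^ : ∀ N b n m → X.mono N b n m ≡ (x^ N ∙ b) n m
mono≡x^ N b n m with ⌊ n ℕ.≟ N ⌋
... | true  = refl
... | false = refl

x^≢0 : ∀ N {b n m} → (x^ N ∙ b) n m ≢ 0ℤ → n ≡ N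
x^≢0 N {n = n} ≢0 with n ℕ.≟ N
... | yes n≡N = n≡N
... | no _    = ⊥-elim (≢0 refl)

monomial : Triple → Series
monomial (i , j , k) = X.mono (1 * i) (α i) X.⊛ (X.mono (2 * j) (β j) X.⊛ X.mono (3 * k) (γ k))

coefficient : Triple → QSeries
coefficient (i , j , k) = α i ⊛ (β j ⊛ γ k)

monomial≋ : ∀ t → monomial t XR.≈ X.mono (total t) (coefficient t)
monomial≋ (i , j , k) = XR.trans
  (XR.*-congˡ {X.mono (1 * i) (α i)} (X.mono-⊛-mono (2 * j) (3 * k) (β j) (γ k)))
  (XR.trans (X.mono-⊛-mono (1 * i) (2 * j + 3 * k) (α i) (β j ⊛ γ k))
    (X.mono-cong (trans (sym (ℕ.+-assoc (1 * i) (2 * j) (3 * k)))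
                          (cong (λ i → i + 2 * j + 3 * k) (ℕ.*-identityˡ i)))
                 (QR.refl {coefficient (i , j , k)})))

-- Cutting each of the three series after `suc n` terms does not change coefficients up to x^n, and
-- the product of the truncations is a finite sum over a box of triples.
G-box : ∀ n → G n ≋ Q∑.∑ (map (λ t → monomial t n) (box (suc n)))
G-box n = QR.trans
  (X.⊛-cong-≤ {A} {TA} {B X.⊛ C} {TB X.⊛ TC} n (trunc≋ 1 α)
    (λ {t} t≤n → X.⊛-cong-≤ {B} {TB} {C} {TC} t
      (λ u≤t → trunc≋ 2 β (ℕ.≤-trans u≤t t≤n)) (λ u≤t → trunc≋ 3 γ (ℕ.≤-trans u≤t t≤n))))
  (QR.trans (XR.trans
      (XR.*-congˡ {TA} (X∑.∑-*-∑ (λ j → X.mono (2 * j) (β j)) (λ k → X.mono (3 * k) (γ k)) D D))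
      (X∑.∑-*-∑ (λ i → X.mono (1 * i) (α i))
        (λ (j , k) → X.mono (2 * j) (β j) X.⊛ X.mono (3 * k) (γ k))
        D (cartesianProduct D D)) n)
    (QR.reflexive (X.∑-at monomial (box (suc n)) n)))
  where
  D = downFrom (suc n)
  TA TB TC : Series
  TA = X.trunc 1 α (suc n)
  TB = X.trunc 2 β (suc n)
  TC = X.trunc 3 γ (suc n)
  trunc≋ : ∀ s .{{_ : ℕ.NonZero s}} a {t} → t ≤ n → X.spread s a t ≋ X.trunc s a (suc n) t
  trunc≋ s a t≤n = QR.sym (X.trunc≈spread s a (s≤s t≤n))

summand : Triple → QSeries
summand (i , j , k) = (-1ℤ ℤ.^ k) · (q^ E ⊛ recip (qpoch 1 i ⊛ qpoch 4 j ⊛ qpoch 6 k))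
  where
  N E : ℕ
  N = i + 2 * j + 3 * k
  E = N * (N ∸ 1) + i + 3 * j + 3 * (k * k) + 3 * k

coefficient≋ : ∀ t → q^ tri (total t) ⊛ coefficient t ≋ summand t
coefficient≋ (i , j , k) = begin
  q^ T ⊛ (q^ i ⊛ ρ₁ ⊛ (q^ (3 * j) ⊛ ρ₂ ⊛ (Q.mono S c ⊛ ρ₃)))
    ≈⟨ QR.*-congˡ {q^ T} (QR.*-congˡ {q^ i ⊛ ρ₁}
         (QR.*-congˡ {q^ (3 * j) ⊛ ρ₂} (QR.*-congʳ {ρ₃} sign))) ⟩
  q^ T ⊛ (q^ i ⊛ ρ₁ ⊛ (q^ (3 * j) ⊛ ρ₂ ⊛ (Q.mono 0 c ⊛ q^ S ⊛ ρ₃)))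
    ≈⟨ QI.regroup (q^ T) (q^ i) ρ₁ (q^ (3 * j)) ρ₂ (Q.mono 0 c) (q^ S) ρ₃ ⟩
  Q.mono 0 c ⊛ (q^ T ⊛ q^ i ⊛ q^ (3 * j) ⊛ q^ S ⊛ (ρ₁ ⊛ ρ₂ ⊛ ρ₃))
    ≈⟨ QR.*-congˡ {Q.mono 0 c} (QR.*-cong
         {q^ T ⊛ q^ i ⊛ q^ (3 * j) ⊛ q^ S} {q^ E} {ρ₁ ⊛ ρ₂ ⊛ ρ₃} {recip (p₁ ⊛ p₂ ⊛ p₃)}
         powers recips≋) ⟩
  Q.mono 0 c ⊛ (q^ E ⊛ recip (p₁ ⊛ p₂ ⊛ p₃))
    ≈⟨ Q.mono-⊛-+ 0 c (q^ E ⊛ recip (p₁ ⊛ p₂ ⊛ p₃)) ⟩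
  c · (q^ E ⊛ recip (p₁ ⊛ p₂ ⊛ p₃)) ∎
  where
  open QReasoning
  T S E : ℕ
  T = tri (total (i , j , k))
  S = 3 * (k * k) + 3 * k
  E = T + i + 3 * j + 3 * (k * k) + 3 * k
  c : ℤ
  c = -1ℤ ℤ.^ k
  p₁ p₂ p₃ ρ₁ ρ₂ ρ₃ : QSeries
  p₁ = qpoch 1 i
  p₂ = qpoch 4 j
  p₃ = qpoch 6 k
  ρ₁ = rpoch 1 i
  ρ₂ = rpoch 4 j
  ρ₃ = rpoch 6 k
  sign : Q.mono S c ≋ Q.mono 0 c ⊛ q^ S
  sign = QR.sym (QR.trans (Q.mono-⊛-mono 0 S c 1ℤ) (Q.mono-cong {S} refl (ℤ.*-identityʳ c)))
  powers : q^ T ⊛ q^ i ⊛ q^ (3 * j) ⊛ q^ S ≋ q^ E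
  powers = begin
    q^ T ⊛ q^ i ⊛ q^ (3 * j) ⊛ q^ S
      ≈⟨ QR.*-congʳ {q^ S} (QR.trans (QR.*-congʳ {q^ (3 * j)} (q^-+ T i)) (q^-+ (T + i) (3 * j))) ⟩
    q^ (T + i + 3 * j) ⊛ q^ S  ≈⟨ q^-+ (T + i + 3 * j) S ⟩
    q^ (T + i + 3 * j + S)     ≈⟨ q^-cong (sym (ℕ.+-assoc (T + i + 3 * j) (3 * (k * k)) (3 * k))) ⟩
    q^ E                       ∎
  recips≋ : ρ₁ ⊛ ρ₂ ⊛ ρ₃ ≋ recip (p₁ ⊛ p₂ ⊛ p₃)
  recips≋ = QR.sym (QR.trans
    (recip-⊛ (p₁ ⊛ p₂) p₃ (cong₂ (λ x y → x ℤ.* y ℤ.+ 0ℤ) (qpoch-constant 1 i) (qpoch-constant 4 j))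
      (qpoch-constant 6 k))
    (QR.*-congʳ {ρ₃} (recip-⊛ p₁ p₂ (qpoch-constant 1 i) (qpoch-constant 4 j))))

f-box : ∀ n → f n ≋ Q∑.∑ (map (λ t → q^ tri n ⊛ monomial t n) (box (suc n)))
f-box n = QR.trans (QR.*-congˡ {q^ tri n} (G-box n))
  (Q∑.*-distribˡ-∑ (q^ tri n) (λ t → monomial t n) (box (suc n)))

monomial≡term : ∀ t n m → (q^ tri n ⊛ monomial t n) m ≡ term t n m
monomial≡term t n m = trans
  (QR.trans (QR.*-congˡ {q^ tri n} (monomial≋ t n))
            -- The monomial vanishes unless n = `total t`, so `tri n` may be replaced by
            -- `tri (total t)`.
            (X.*-mono (λ n → q^ tri n) (total t) (coefficient t) n) m)
  (trans (mono≡x^ (total t) (q^ tri (total t) ⊛ coefficient t) n m)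
           (x^-cong (total t) (coefficient≋ t) n m))

hasSum-term : HasSum U term f
hasSum-term n m =
  box (suc n) ,
  Unique.cartesianProduct⁺ (Unique.downFrom⁺ (suc n))
    (Unique.cartesianProduct⁺ (Unique.downFrom⁺ (suc n)) (Unique.downFrom⁺ (suc n))) ,
  All.tabulate (λ _ → tt) ,
  (λ (i , j , k) _ ≢0 → in-box i j k (x^≢0 (i + 2 * j + 3 * k) {summand (i , j , k)} {n} {m} ≢0)) ,
  trans (f-box n m)
    (trans (Q.∑-at (λ t → q^ tri n ⊛ monomial t n) (box (suc n)) m)
       (Z∑.∑-cong (λ t → monomial≡term t n m) (box (suc n))))
  where
  module Z∑ = FiniteSums ℤ.+-*-commutativeRing
  in-box : ∀ i j k → n ≡ i + 2 * j + 3 * k → (i , j , k) ∈ box (suc n)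
  in-box i j k refl = ∈-cartesianProduct⁺ (∈-downFrom⁺ (s≤s i≤))
    (∈-cartesianProduct⁺ (∈-downFrom⁺ (s≤s j≤)) (∈-downFrom⁺ (s≤s k≤)))
    where
    i≤ : i ≤ i + 2 * j + 3 * k
    i≤ = ℕ.≤-trans (ℕ.m≤m+n i (2 * j)) (ℕ.m≤m+n (i + 2 * j) (3 * k))
    j≤ : j ≤ i + 2 * j + 3 * k
    j≤ = ℕ.≤-trans (ℕ.≤-trans (ℕ.m≤n*m j 2) (ℕ.m≤n+m (2 * j) i)) (ℕ.m≤m+n (i + 2 * j) (3 * k))
    k≤ : k ≤ i + 2 * j + 3 * k
    k≤ = ℕ.≤-trans (ℕ.m≤n*m k 3) (ℕ.m≤n+m (3 * k) (i + 2 * j))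

-- The conditions of 𝒫 in local form

Step : ℕ → ℕ → Set
Step a b = a < b × ¬ (b ≡ 1 + a × 2 ∣ b)

-- The forbidden triples with 2j = `a`. Stated through the parity of `a` and the differences, they
-- can be moved along an even translation.
Bad : ℕ → ℕ → ℕ → Set
Bad a b c = 2 ∣ a × ((b ≡ 1 + a × c ≡ 3 + a) ⊎ (b ≡ 2 + a × c ≡ 3 + a) ⊎ (b ≡ 2 + a × c ≡ 4 + a))

Front : ℕ → List ℕ → Set
Front a []          = ⊤
Front a (b ∷ [])    = Step a b
Front a (b ∷ c ∷ _) = Step a b × ¬ Bad a b c

Admissible : List ℕ → Set
Admissible []      = ⊤
Admissible (a ∷ π) = Front a π × Admissible π

Above : ℕ → List ℕ → Set
Above l []      = ⊤
Above l (a ∷ _) = l < a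

-- 𝒟 l: the partitions in 𝒫 with all parts > l (see 𝒫⇒𝒟 and 𝒟⇒𝒫)
𝒟 : ℕ → List ℕ → Set
𝒟 l π = Admissible π × Above l π

front-step : ∀ {a b} π → Front a (b ∷ π) → Step a b
front-step []      s       = s
front-step (_ ∷ _) (s , _) = s

front-intro : ∀ {a b} π → Step a b → (∀ c → ¬ Bad a b c) → Front a (b ∷ π)
front-intro []      s 𝒫-good = s
front-intro (c ∷ π) s 𝒫-good = s , 𝒫-good c

𝒟-weaken : ∀ {l m} → l ≤ m → ∀ {π} → 𝒟 m π → 𝒟 l π
𝒟-weaken l≤m {[]}    (p , _)   = p , tt
𝒟-weaken l≤m {_ ∷ _} (p , m<a) = p , ℕ.≤-<-trans l≤m m<a

tail-above : ∀ {l a} π → 𝒟 l (a ∷ π) → 𝒟 a π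
tail-above []      ((_ , p) , _) = p , tt
tail-above (b ∷ π) ((f , p) , _) = p , proj₁ (front-step π f)

private
  even→double : ∀ {a} → 2 ∣ a → ∃[ j ] ℤ.+ a ≡ ℤ.+ 2 ℤ.* j
  even→double (divides k refl) = ℤ.+ k , trans (ℤ.pos-* k 2) (ℤ.*-comm (ℤ.+ k) (ℤ.+ 2))

  double→even : ∀ {a} j → ℤ.+ a ≡ ℤ.+ 2 ℤ.* j → 2 ∣ a
  -- A priori `j` may be negative; taking absolute values avoids a case distinction.
  double→even {a} j eq = divides ℤ.∣ j ∣
    (trans (cong ℤ.∣_∣ eq) (trans (ℤ.abs-* (ℤ.+ 2) j) (ℕ.*-comm 2 ℤ.∣ j ∣)))

  occurs : ∀ {a b c π d x y} → ℤ.+ a ≡ d → b ≡ x + a → c ≡ y + a →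
           (d ∷ d ℤ.+ ℤ.+ x ∷ d ℤ.+ ℤ.+ y ∷ []) OccursIn (a ∷ b ∷ c ∷ π)
  occurs {a} {x = x} {y} refl refl refl =
    here (refl ∷ cong ℤ.+_ (ℕ.+-comm a x) ∷ cong ℤ.+_ (ℕ.+-comm a y) ∷ [])

  offset : ∀ {a b d} x → d ≡ ℤ.+ a → d ℤ.+ ℤ.+ x ≡ ℤ.+ b → b ≡ x + a
  offset {a} x refl eq = trans (sym (ℤ.+-injective eq)) (ℕ.+-comm a x)

  𝒫-good : ∀ {a b c π} → 𝒫 (a ∷ b ∷ c ∷ π) → ¬ Bad a b c
  𝒫-good p (even , bad) with even→double even | bad
  ... | j , eq | inj₁ (b≡ , c≡)        = 𝒫.noForbidden₁ p j (occurs eq b≡ c≡)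
  ... | j , eq | inj₂ (inj₁ (b≡ , c≡)) = 𝒫.noForbidden₂ p j (occurs eq b≡ c≡)
  ... | j , eq | inj₂ (inj₂ (b≡ , c≡)) = 𝒫.noForbidden₃ p j (occurs eq b≡ c≡)

  𝒫-step : ∀ {a b π} → 𝒫 (a ∷ b ∷ π) → Step a b
  𝒫-step p with 𝒫.isPartition p | 𝒫.noRepeats p | 𝒫.evenGap p
  ... | record { increasing = a≤b ∷ _ } | (a≢b ∷ _) ∷ _ | gap ∷ _ =
    ℕ.≤∧≢⇒< a≤b a≢b , gap

  𝒫-front : ∀ {a} π → 𝒫 (a ∷ π) → Front a π
  𝒫-front []          p = tt
  𝒫-front (b ∷ [])    p = 𝒫-step p
  𝒫-front (b ∷ c ∷ π) p = 𝒫-step p , 𝒫-good p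

  𝒫-tail : ∀ {a π} → 𝒫 (a ∷ π) → 𝒫 π
  𝒫-tail p = record
    { isPartition  = record
      { positive   = All.tail positive
      ; increasing = Linked.tail increasing }
    ; noRepeats    = unique-tail noRepeats
    ; evenGap      = Linked.tail evenGap
    ; noForbidden₁ = λ j → noForbidden₁ j ∘ there
    ; noForbidden₂ = λ j → noForbidden₂ j ∘ there
    ; noForbidden₃ = λ j → noForbidden₃ j ∘ there }
    where
    open 𝒫 p
    open IsPartition isPartition
    unique-tail : ∀ {a : ℕ} {π} → Unique (a ∷ π) → Unique π
    unique-tail (_ ∷ u) = u

  all-above : ∀ {l} π → 𝒟 l π → All (l <_) π
  all-above []      _ = []
  all-above (a ∷ π) d = proj₂ d ∷ All.map (ℕ.<-trans (proj₂ d)) (all-above π (tail-above π d))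

  no-triple : ∀ {d x y} → (∀ {a b c} → d ≡ ℤ.+ a → b ≡ x + a → c ≡ y + a → Bad a b c) →
              ∀ π → Admissible π → ¬ (d ∷ d ℤ.+ ℤ.+ x ∷ d ℤ.+ ℤ.+ y ∷ []) OccursIn π
  no-triple bad []              _             (here ())
  no-triple bad (a ∷ π)         (_ , p)       (there i) = no-triple bad π p i
  no-triple bad (a ∷ [])        _             (here (_ ∷ ()))
  no-triple bad (a ∷ _ ∷ [])    _             (here (_ ∷ _ ∷ ()))
  no-triple {x = x} {y} bad (a ∷ b ∷ c ∷ π) ((_ , ok) , _) (here (p ∷ q ∷ r ∷ _)) =
    ok (bad p (offset x p q) (offset y p r))

𝒫⇒𝒟 : ∀ π → 𝒫 π → 𝒟 0 π
𝒫⇒𝒟 []      p = tt , tt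
𝒫⇒𝒟 (a ∷ π) p = (𝒫-front π p , proj₁ (𝒫⇒𝒟 π (𝒫-tail p))) ,
                 All.head (IsPartition.positive (𝒫.isPartition p))

𝒟⇒𝒫 : ∀ π → 𝒟 0 π → 𝒫 π
𝒟⇒𝒫 π d = record
  { isPartition  = record { positive = all-above π d ; increasing = increasing π d }
  ; noRepeats    = unique π d
  ; evenGap      = gaps π d
  ; noForbidden₁ = λ j → no-triple
      (λ eq b≡ c≡ → double→even j (sym eq) , inj₁ (b≡ , c≡)) π (proj₁ d)
  ; noForbidden₂ = λ j → no-triple
      (λ eq b≡ c≡ → double→even j (sym eq) , inj₂ (inj₁ (b≡ , c≡))) π (proj₁ d)
  ; noForbidden₃ = λ j → no-triple
      (λ eq b≡ c≡ → double→even j (sym eq) , inj₂ (inj₂ (b≡ , c≡))) π (proj₁ d) }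
  where
  increasing : ∀ {l} π → 𝒟 l π → Linked _≤_ π
  increasing []          _ = []
  increasing (_ ∷ [])    _ = [-]
  increasing (_ ∷ b ∷ π) d =
    ℕ.<⇒≤ (proj₂ (tail-above (b ∷ π) d)) ∷ increasing (b ∷ π) (tail-above (b ∷ π) d)
  unique : ∀ {l} π → 𝒟 l π → Unique π
  unique []      _ = []
  unique (a ∷ π) d = All.map ℕ.<⇒≢ (all-above π (tail-above π d)) ∷ unique π (tail-above π d)
  gaps : ∀ {l} π → 𝒟 l π → Linked (λ a b → ¬ (b ≡ suc a × 2 ∣ b)) π
  gaps []          _ = []
  gaps (_ ∷ [])    _ = [-]
  gaps (_ ∷ b ∷ π) d =
    proj₂ (front-step π (proj₁ (proj₁ d))) ∷ gaps (b ∷ π) (tail-above (b ∷ π) d)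

-- Invariance under even translations

module _ {s} (2∣s : 2 ∣ s) where
  private
    lift-even : ∀ {a} → 2 ∣ a → 2 ∣ s + a
    lift-even = ∣m∣n⇒∣m+n 2∣s

    lower-even : ∀ {a} → 2 ∣ s + a → 2 ∣ a
    lower-even e = ∣m+n∣m⇒∣n e 2∣s

    swap : ∀ x a → s + (x + a) ≡ x + (s + a)
    swap x a = trans (sym (ℕ.+-assoc s x a))
      (trans (cong (_+ a) (ℕ.+-comm s x)) (ℕ.+-assoc x s a))

    lift-gap : ∀ {a b} x → b ≡ x + a → s + b ≡ x + (s + a)
    lift-gap {a} x refl = swap x a

    lower-gap : ∀ {a b} x → s + b ≡ x + (s + a) → b ≡ x + a
    lower-gap {a} {b} x eq = ℕ.+-cancelˡ-≡ s b (x + a) (trans eq (sym (swap x a)))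

    lift-step : ∀ {a b} → Step a b → Step (s + a) (s + b)
    lift-step (a<b , gap) =
      ℕ.+-monoʳ-< s a<b , λ (eq , e) → gap (lower-gap 1 eq , lower-even e)

    lower-step : ∀ {a b} → Step (s + a) (s + b) → Step a b
    lower-step (a<b , gap) =
      ℕ.+-cancelˡ-< s _ _ a<b , λ (eq , e) → gap (lift-gap 1 eq , lift-even e)

    lift-bad : ∀ {a b c} → Bad a b c → Bad (s + a) (s + b) (s + c)
    lift-bad (e , inj₁ (p , r))        = lift-even e , inj₁ (lift-gap 1 p , lift-gap 3 r)
    lift-bad (e , inj₂ (inj₁ (p , r))) = lift-even e , inj₂ (inj₁ (lift-gap 2 p , lift-gap 3 r))
    lift-bad (e , inj₂ (inj₂ (p , r))) = lift-even e , inj₂ (inj₂ (lift-gap 2 p , lift-gap 4 r))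

    lower-bad : ∀ {a b c} → Bad (s + a) (s + b) (s + c) → Bad a b c
    lower-bad (e , inj₁ (p , r))        = lower-even e , inj₁ (lower-gap 1 p , lower-gap 3 r)
    lower-bad (e , inj₂ (inj₁ (p , r))) = lower-even e , inj₂ (inj₁ (lower-gap 2 p , lower-gap 3 r))
    lower-bad (e , inj₂ (inj₂ (p , r))) = lower-even e , inj₂ (inj₂ (lower-gap 2 p , lower-gap 4 r))

    lift-front : ∀ {a} π → Front a π → Front (s + a) (map (s +_) π)
    lift-front []          _          = tt
    lift-front (_ ∷ [])    st         = lift-step st
    lift-front (_ ∷ _ ∷ _) (st , ok)  = lift-step st , ok ∘ lower-bad

    lower-front : ∀ {a} π → Front (s + a) (map (s +_) π) → Front a π
    lower-front []          _         = tt
    lower-front (_ ∷ [])    st        = lower-step st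
    lower-front (_ ∷ _ ∷ _) (st , ok) = lower-step st , ok ∘ lift-bad

    lift-admissible : ∀ π → Admissible π → Admissible (map (s +_) π)
    lift-admissible []      _       = tt
    lift-admissible (_ ∷ π) (f , p) = lift-front π f , lift-admissible π p

    lower-admissible : ∀ π → Admissible (map (s +_) π) → Admissible π
    lower-admissible []      _       = tt
    lower-admissible (_ ∷ π) (f , p) = lower-front π f , lower-admissible π p

    above-preimage : ∀ π → 𝒟 s π → ∃[ ρ ] π ≡ map (s +_) ρ
    above-preimage []      d = [] , refl
    above-preimage (a ∷ π) d
      with ρ , refl ← above-preimage π (𝒟-weaken (ℕ.<⇒≤ (proj₂ d)) {π} (tail-above π d))
      with b , refl ← ℕ.m≤n⇒∃[o]m+o≡n (ℕ.<⇒≤ (proj₂ d)) = b ∷ ρ , refl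

  𝒟-translate : ∀ {l} π → 𝒟 l π → 𝒟 (s + l) (map (s +_) π)
  𝒟-translate []      (p , _)   = p , tt
  𝒟-translate (a ∷ π) (p , l<a) = lift-admissible (a ∷ π) p , ℕ.+-monoʳ-< s l<a

  𝒟-untranslate : ∀ {l} π → 𝒟 (s + l) π → ∃[ ρ ] 𝒟 l ρ × π ≡ map (s +_) ρ
  𝒟-untranslate {l} π d with above-preimage π (𝒟-weaken (ℕ.m≤m+n s l) {π} d)
  ... | []    , refl = [] , (tt , tt) , refl
  ... | b ∷ ρ , refl =
    b ∷ ρ , (lower-admissible (b ∷ ρ) (proj₁ d) , ℕ.+-cancelˡ-< s l b (proj₂ d)) , refl

-- Splitting off the smallest parts

_▸_ : List ℕ → ℕ → List ℕ → Set
(ρ ▸ l) π = ∃[ σ ] 𝒟 l σ × π ≡ ρ ++ σ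

private
  2∤1 : ¬ 2 ∣ 1
  2∤1 = from-no (2 ∣? 1)

  2∤3 : ¬ 2 ∣ 3
  2∤3 = from-no (2 ∣? 3)

  2∣2 : 2 ∣ 2
  2∣2 = divides 1 refl

  2∣4 : 2 ∣ 4
  2∣4 = divides 2 refl

  2∣6 : 2 ∣ 6
  2∣6 = divides 3 refl

  odd-good : ∀ {a b c} → ¬ 2 ∣ a → ¬ Bad a b c
  odd-good odd (even , _) = odd even

  distant : ∀ {a b} → 2 + a ≤ b → Step a b
  distant {a} 2+a≤b = ℕ.<⇒≤ 2+a≤b , λ (eq , _) → ℕ.<-irrefl (sym eq) 2+a≤b

  distant-good : ∀ {a b c} → 3 + a ≤ b → ¬ Bad a b c
  distant-good 3+a≤b (_ , inj₁ (refl , _))        = ℕ.<-irrefl refl (ℕ.<⇒≤ 3+a≤b)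
  distant-good 3+a≤b (_ , inj₂ (inj₁ (refl , _))) = ℕ.<-irrefl refl 3+a≤b
  distant-good 3+a≤b (_ , inj₂ (inj₂ (refl , _))) = ℕ.<-irrefl refl 3+a≤b

  23-good : ∀ {c} → c ≢ 5 → ¬ Bad 2 3 c
  23-good c≢5 (_ , inj₁ (_ , c≡5)) = c≢5 c≡5
  23-good c≢5 (_ , inj₂ (inj₁ (() , _)))
  23-good c≢5 (_ , inj₂ (inj₂ (() , _)))

  24-good : ∀ {c} → c ≢ 5 → c ≢ 6 → ¬ Bad 2 4 c
  24-good c≢5 c≢6 (_ , inj₁ (() , _))
  24-good c≢5 c≢6 (_ , inj₂ (inj₁ (_ , c≡5))) = c≢5 c≡5
  24-good c≢5 c≢6 (_ , inj₂ (inj₂ (_ , c≡6))) = c≢6 c≡6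

  cons : ∀ a {l} π → 𝒟 l π →
         (∀ b → l < b → Step a b) → (∀ b c → l < b → ¬ Bad a b c) → Front a π × Admissible π
  cons a []      (p , _)   st good = tt , p
  cons a (b ∷ π) (p , l<b) st good = front-intro π (st b l<b) (λ c → good b c l<b) , p

  above-suc : ∀ {l} π → 𝒟 l π → (∀ σ → π ≢ suc l ∷ σ) → 𝒟 (suc l) π
  above-suc []      (p , _)   _  = p , tt
  above-suc (a ∷ π) (p , l<a) ≢  = p , ℕ.≤∧≢⇒< l<a λ { refl → ≢ π refl }

-- After 1, the part 2 is excluded as an even successor. No forbidden triple starts at an odd part,
-- so the parts above 2 are not constrained further.
𝒟₀-split : ∀ π → 𝒟 0 π → ((1 ∷ []) ▸ 2) π ⊎ 𝒟 1 π
𝒟₀-split []                  d = inj₂ (tt , tt)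
𝒟₀-split (suc (suc a) ∷ π)   d = inj₂ (proj₁ d , s≤s (s≤s z≤n))
𝒟₀-split (zero ∷ π)          (_ , ())
𝒟₀-split (1 ∷ π)             d = inj₁ (π , above-suc π (tail-above π d) no-2 , refl)
  where
  no-2 : ∀ σ → π ≢ 2 ∷ σ
  no-2 σ refl = proj₂ (front-step σ (proj₁ (proj₁ d))) (refl , 2∣2)

𝒟₀-join : ∀ π → ((1 ∷ []) ▸ 2) π ⊎ 𝒟 1 π → 𝒟 0 π
𝒟₀-join π (inj₂ d)              = 𝒟-weaken z≤n {π} d
𝒟₀-join _ (inj₁ (σ , d , refl)) =
  cons 1 σ d (λ _ → distant) (λ _ _ _ → odd-good 2∤1) , s≤s z≤n

-- After 2, 3 the part 4 is an even successor and 5 completes 2+3+5; after 2, 4 the parts 5 and 6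
-- complete 2+4+5 and 2+4+6. In every case the bound makes the rules across the junction automatic,
-- so the remainder is arbitrary above it. The bounds are 2+0, 4+0, 4+1 and 6+0; the odd bound 5 is
-- the reason why `𝒟 1` has to be counted along with `𝒟 0`.
𝒟₁-Parts : List ℕ → Set
𝒟₁-Parts π = ([] ▸ 2) π ⊎ ((2 ∷ []) ▸ 4) π ⊎ ((2 ∷ 3 ∷ []) ▸ 5) π ⊎ ((2 ∷ 4 ∷ []) ▸ 6) π

𝒟₁-split : ∀ π → 𝒟 1 π → 𝒟₁-Parts π
𝒟₁-split []                            d = inj₁ ([] , (tt , tt) , refl)
𝒟₁-split (zero ∷ π)                    (_ , ())
𝒟₁-split (1 ∷ π)                       (_ , s≤s ())
𝒟₁-split (suc (suc (suc a)) ∷ π)       d = inj₁ (_ , (proj₁ d , s≤s (s≤s (s≤s z≤n))) , refl)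
𝒟₁-split (2 ∷ [])                      d = inj₂ (inj₁ ([] , (tt , tt) , refl))
𝒟₁-split (2 ∷ b ∷ π)                   d with tail-above (b ∷ π) d
𝒟₁-split (2 ∷ suc (suc zero) ∷ π)      d | _ , s≤s (s≤s ())
𝒟₁-split (2 ∷ 3 ∷ π)                   d | d′ =
  inj₂ (inj₂ (inj₁ (π , above-suc π (above-suc π (tail-above π d′) no-4) (no-5 π d) , refl)))
  where
  no-4 : ∀ σ → π ≢ 4 ∷ σ
  no-4 σ refl = proj₂ (front-step σ (proj₁ (proj₁ d′))) (refl , 2∣4)
  no-5 : ∀ π → 𝒟 1 (2 ∷ 3 ∷ π) → ∀ σ → π ≢ 5 ∷ σ
  no-5 _ ((( _ , good) , _) , _) σ refl = good (2∣2 , inj₁ (refl , refl))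
𝒟₁-split (2 ∷ 4 ∷ π)                   d | d′ =
  inj₂ (inj₂ (inj₂ (π , above-suc π (above-suc π (tail-above π d′) (no-5 π d)) (no-6 π d) , refl)))
  where
  no-5 : ∀ π → 𝒟 1 (2 ∷ 4 ∷ π) → ∀ σ → π ≢ 5 ∷ σ
  no-5 _ ((( _ , good) , _) , _) σ refl = good (2∣2 , inj₂ (inj₁ (refl , refl)))
  no-6 : ∀ π → 𝒟 1 (2 ∷ 4 ∷ π) → ∀ σ → π ≢ 6 ∷ σ
  no-6 _ ((( _ , good) , _) , _) σ refl = good (2∣2 , inj₂ (inj₂ (refl , refl)))
𝒟₁-split (2 ∷ suc (suc (suc (suc (suc b)))) ∷ π) d | p , _ =
  inj₂ (inj₁ (_ , (p , s≤s (s≤s (s≤s (s≤s (s≤s z≤n))))) , refl))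

𝒟₁-join : ∀ π → 𝒟₁-Parts π → 𝒟 1 π
𝒟₁-join _ (inj₁ (σ , d , refl)) = 𝒟-weaken (s≤s z≤n) {σ} d
𝒟₁-join _ (inj₂ (inj₁ (σ , d , refl))) =
  cons 2 σ d (λ _ → distant ∘ ℕ.<⇒≤) (λ _ _ → distant-good) , s≤s (s≤s z≤n)
𝒟₁-join _ (inj₂ (inj₂ (inj₁ (σ , d , refl)))) = (front σ d , tail) , s≤s (s≤s z≤n)
  where
  tail : Admissible (3 ∷ σ)
  tail = cons 3 σ d (λ _ → distant ∘ ℕ.<⇒≤) (λ _ _ _ → odd-good 2∤3)
  2-3 : Step 2 3
  2-3 = ℕ.≤-refl , 2∤3 ∘ proj₂
  front : ∀ σ → 𝒟 5 σ → Front 2 (3 ∷ σ)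
  front []      _         = 2-3
  front (c ∷ σ) (_ , 5<c) = 2-3 , 23-good (ℕ.<⇒≢ 5<c ∘ sym)
𝒟₁-join _ (inj₂ (inj₂ (inj₂ (σ , d , refl)))) = (front σ d , tail) , s≤s (s≤s z≤n)
  where
  tail : Admissible (4 ∷ σ)
  tail = cons 4 σ d (λ _ → distant ∘ ℕ.<⇒≤) (λ _ _ → distant-good)
  2-4 : Step 2 4
  2-4 = distant ℕ.≤-refl
  front : ∀ σ → 𝒟 6 σ → Front 2 (4 ∷ σ)
  front []      _         = 2-4
  front (c ∷ σ) (_ , 6<c) = 2-4 , 24-good (λ { refl → ℕ.<⇒≱ 6<c (ℕ.n≤1+n 5) }) (ℕ.<⇒≢ 6<c ∘ sym)

-- Counting partitions

-- A repetition-free enumeration is carried along because `HasSum` asks for such a list; `c` is an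
-- integer so that it can be a coefficient of a `QSeries`.
Count : (List ℕ → Set) → ℤ → Set
Count P c = ∃[ πs ] Unique πs × (∀ π → π ∈ πs → P π) × (∀ π → P π → π ∈ πs) × c ≡ ℤ.+ length πs

count-cong : ∀ {P Q c d} → (∀ π → P π → Q π) → (∀ π → Q π → P π) → d ≡ c → Count P c → Count Q d
count-cong to from eq (πs , u , sound , complete , c≡) =
  πs , u , (λ π → to π ∘ sound π) , (λ π → complete π ∘ from π) , trans eq c≡

count-≡ : ∀ {P c d} → d ≡ c → Count P c → Count P d
count-≡ eq (πs , u , sound , complete , c≡) = πs , u , sound , complete , trans eq c≡

count-∅ : ∀ {P} → (∀ π → ¬ P π) → Count P 0ℤ
count-∅ none = [] , [] , (λ π ()) , (λ π p → ⊥-elim (none π p)) , refl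

count-⊎ : ∀ {P Q c d} → (∀ π → P π → ¬ Q π) → Count P c → Count Q d →
          Count (λ π → P π ⊎ Q π) (c ℤ.+ d)
count-⊎ disjoint (πs , u , sound , complete , refl) (πs′ , u′ , sound′ , complete′ , refl) =
  πs ++ πs′ , Unique.++⁺ u u′ (λ (p , q) → disjoint _ (sound _ p) (sound′ _ q)) ,
  (λ π → Sum.map (sound π) (sound′ π) ∘ ∈-++⁻ πs) ,
  (λ π → [ ∈-++⁺ˡ ∘ complete π , ∈-++⁺ʳ πs ∘ complete′ π ]′) ,
  cong ℤ.+_ (sym (length-++ πs))

count-image : ∀ {P c} (g : List ℕ → List ℕ) → (∀ {π ρ} → g π ≡ g ρ → π ≡ ρ) →
              Count P c → Count (λ π → ∃[ ρ ] P ρ × π ≡ g ρ) c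
count-image {P} g inj (πs , u , sound , complete , refl) =
  map g πs , Unique.map⁺ inj u ,
  (λ π π∈ → let ρ , ρ∈ , eq = ∈-map⁻ g π∈ in ρ , sound ρ ρ∈ , eq) ,
  (λ { _ (ρ , p , refl) → ∈-map⁺ g (complete ρ p) }) ,
  cong ℤ.+_ (sym (length-map g πs))

Sized : (List ℕ → Set) → ℕ → ℕ → List ℕ → Set
Sized P n m π = P π × length π ≡ n × sum π ≡ m

sized-⊎ : ∀ {P Q n m c d} → (∀ π → P π → ¬ Q π) →
          Count (Sized P n m) c → Count (Sized Q n m) d →
          Count (Sized (λ π → P π ⊎ Q π) n m) (c ℤ.+ d)
sized-⊎ disjoint x y = count-cong
  (λ π → [ (λ (p , e) → inj₁ p , e) , (λ (q , e) → inj₂ q , e) ]′)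
  (λ { π (inj₁ p , e) → inj₁ (p , e) ; π (inj₂ q , e) → inj₂ (q , e) })
  refl (count-⊎ (λ π (p , _) (q , _) → disjoint π p q) x y)

sum-translate : ∀ s π → sum (map (s +_) π) ≡ s * length π + sum π
sum-translate s []      = cong (_+ 0) (sym (ℕ.*-zeroʳ s))
sum-translate s (a ∷ π) = trans (cong (s + a +_) (sum-translate s π))
  (solve 4 (λ s a l t → s :+ a :+ (s :* l :+ t) := s :* (con 1 :+ l) :+ (a :+ t)) refl
    s a (length π) (sum π))
  where open +-*-Solver

length-▸ : ∀ ρ s τ → length (ρ ++ map (s +_) τ) ≡ length ρ + length τ
length-▸ ρ s τ = trans (length-++ ρ) (cong (length ρ +_) (length-map (s +_) τ))

sum-▸ : ∀ ρ s τ → sum (ρ ++ map (s +_) τ) ≡ sum ρ + s * length τ + sum τ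
sum-▸ ρ s τ = trans (sum-++ ρ (map (s +_) τ))
  (trans (cong (sum ρ +_) (sum-translate s τ)) (sym (ℕ.+-assoc (sum ρ) _ _)))

-- Adding `s` to each of `n` parts and prefixing `ρ` raises the sum by `e`, which multiplies the
-- generating function by q^e. Counts are requested only at m′ = m - e, so an induction on `m` can
-- supply them; for m < e both sides are zero.
count-▸ : ∀ ρ {s} → 2 ∣ s → ∀ l n m b → let e = sum ρ + s * n in
  (∀ m′ → e + m′ ≡ m → Count (Sized (𝒟 l) n m′) (b m′)) →
  Count (Sized (ρ ▸ (s + l)) (length ρ + n) m) ((q^ e ⊛ b) m)
count-▸ ρ {s} 2∣s l n m b counts with m ℕ.<? sum ρ + s * n
... | yes m<e = count-≡ (Q.mono-⊛-< {sum ρ + s * n} 1ℤ b m<e) (count-∅ empty)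
  where
  empty : ∀ π → ¬ Sized (ρ ▸ (s + l)) (length ρ + n) m π
  empty π ((σ , d , refl) , len , refl) with τ , _ , refl ← 𝒟-untranslate 2∣s σ d
    with refl ← ℕ.+-cancelˡ-≡ (length ρ) _ _ (trans (sym (length-▸ ρ s τ)) len) =
    ℕ.<⇒≱ m<e (ℕ.≤-trans (ℕ.m≤m+n _ (sum τ)) (ℕ.≤-reflexive (sym (sum-▸ ρ s τ))))
... | no m≮e with m′ , refl ← ℕ.m≤n⇒∃[o]m+o≡n (ℕ.≮⇒≥ m≮e) =
  count-cong to from (trans (Q.mono-⊛-+ (sum ρ + s * n) 1ℤ b m′) (ℤ.*-identityˡ (b m′)))
    (count-image g
      (λ eq → map-injective (ℕ.+-cancelˡ-≡ s _ _) (++-cancelˡ ρ _ _ eq)) (counts m′ refl))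
  where
  g : List ℕ → List ℕ
  g τ = ρ ++ map (s +_) τ
  to : ∀ π → (∃[ τ ] Sized (𝒟 l) n m′ τ × π ≡ g τ) →
       Sized (ρ ▸ (s + l)) (length ρ + n) (sum ρ + s * n + m′) π
  to _ (τ , (d , refl , refl) , refl) =
    (map (s +_) τ , 𝒟-translate 2∣s τ d , refl) , length-▸ ρ s τ , sum-▸ ρ s τ
  from : ∀ π → Sized (ρ ▸ (s + l)) (length ρ + n) (sum ρ + s * n + m′) π →
         ∃[ τ ] Sized (𝒟 l) n m′ τ × π ≡ g τ
  from _ ((σ , d , refl) , len , eq) with τ , d′ , refl ← 𝒟-untranslate 2∣s σ d
    with refl ← ℕ.+-cancelˡ-≡ (length ρ) _ _ (trans (sym (length-▸ ρ s τ)) len) =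
    τ , (d′ , refl , ℕ.+-cancelˡ-≡ (sum ρ + s * length τ) _ _ (trans (sym (sum-▸ ρ s τ)) eq)) , refl

count-[] : ∀ l m → Count (Sized (𝒟 l) 0 m) (one m)
count-[] l zero = ([] ∷ []) , ([] ∷ []) , (λ { _ (here refl) → (tt , tt) , refl , refl }) ,
  (λ { [] _ → here refl ; (_ ∷ _) (_ , () , _) }) , refl
count-[] l (suc m) = count-∅ λ { [] (_ , _ , ()) ; (_ ∷ _) (_ , () , _) }

private
  lift : ∀ {P Q : List ℕ → Set} {n m} → (∀ π → P π → Q π) → ∀ π → Sized P n m π → Sized Q n m π
  lift to π (p , e) = to π p , e

  disjoint-1 : ∀ π → ((1 ∷ []) ▸ 2) π → ¬ 𝒟 1 π
  disjoint-1 _ (σ , _ , refl) (_ , s≤s ())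

  disjoint-2 : ∀ π → ([] ▸ 2) π → ¬ (((2 ∷ []) ▸ 4) π ⊎ ((2 ∷ 3 ∷ []) ▸ 5) π ⊎ ((2 ∷ 4 ∷ []) ▸ 6) π)
  disjoint-2 _ (_ , (_ , s≤s (s≤s ())) , refl) (inj₁ (_ , _ , refl))
  disjoint-2 _ (_ , (_ , s≤s (s≤s ())) , refl) (inj₂ (inj₁ (_ , _ , refl)))
  disjoint-2 _ (_ , (_ , s≤s (s≤s ())) , refl) (inj₂ (inj₂ (_ , _ , refl)))

  disjoint-4 : ∀ π → ((2 ∷ []) ▸ 4) π → ¬ (((2 ∷ 3 ∷ []) ▸ 5) π ⊎ ((2 ∷ 4 ∷ []) ▸ 6) π)
  disjoint-4 _ (_ , (_ , s≤s (s≤s (s≤s ()))) , refl) (inj₁ (_ , _ , refl))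
  disjoint-4 _ (_ , (_ , s≤s (s≤s (s≤s (s≤s ())))) , refl) (inj₂ (_ , _ , refl))

  disjoint-5 : ∀ π → ((2 ∷ 3 ∷ []) ▸ 5) π → ¬ ((2 ∷ 4 ∷ []) ▸ 6) π
  disjoint-5 _ (_ , _ , refl) (_ , _ , ())

  smaller : ∀ {e m m′ M} → 0 < e → e + m′ ≡ m → m < suc M → m′ < M
  smaller {m′ = m′} 0<e refl (s≤s m≤M) = ℕ.<-≤-trans (ℕ.m<n+m m′ 0<e) m≤M

weight≢0 : ∀ π {n m} → weight π n m ≢ 0ℤ → length π ≡ n × sum π ≡ m
weight≢0 π {n} {m} ≢0 with n ℕ.≟ length π | m ℕ.≟ sum π
... | yes refl | yes refl = refl , refl
... | yes _    | no _     = ⊥-elim (≢0 refl)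
... | no _     | _        = ⊥-elim (≢0 refl)

∑-ones : ∀ {I : Set} (g : I → ℤ) is → All (λ i → g i ≡ 1ℤ) is → ∑ (map g is) ≡ ℤ.+ length is
∑-ones g []       []         = refl
∑-ones g (i ∷ is) (gi ∷ gis) = cong₂ ℤ._+_ gi (∑-ones g is gis)

if-refl : ∀ n {c d : ℤ} → (if ⌊ n ℕ.≟ n ⌋ then c else d) ≡ c
if-refl n with n ℕ.≟ n
... | yes _  = refl
... | no n≢n = ⊥-elim (n≢n refl)

weight≡1 : ∀ π → weight π (length π) (sum π) ≡ 1ℤ
weight≡1 π = trans (if-refl (length π)) (if-refl (sum π))

-- The counts obey the recurrences

module Recurrences
  (f a : ℕ → QSeries) (f-zero : f 0 ≋ one) (a-zero : a 0 ≋ one)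
  (f-suc : ∀ n → f (suc n) ≋ q^ (1 + 2 * n) ⊛ f n QR.+ a (suc n))
  (a-one : a 1 ≋ q^ (0 + 2 * 1) ⊛ f 1 QR.+ q^ (2 + 4 * 0) ⊛ f 0)
  (a-suc² : ∀ n → a (2 + n) ≋
    q^ (0 + 2 * (2 + n)) ⊛ f (2 + n) QR.+ (q^ (2 + 4 * (1 + n)) ⊛ f (1 + n) QR.+
    (q^ (5 + 4 * n) ⊛ a n QR.+ q^ (6 + 6 * n) ⊛ f n)))
  where

  -- Induction on the bound `M` for the sum `m`, for all `n` at once. Each appeal to `counts` strips
  -- a positive power of q and so lowers `m`; only the call from `counts₀` to `counts₁` keeps `m`,
  -- and `counts₁` never calls back at the same `m`.
  counts : ∀ M m → m < M → ∀ n → Count (Sized (𝒟 0) n m) (f n m) × Count (Sized (𝒟 1) n m) (a n m)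

  counts₁ : ∀ M m → m < suc M → ∀ n → Count (Sized (𝒟 1) n m) (a n m)
  -- For n = 0 the power q^(2n) is trivial and the recursion would not descend, so the empty
  -- partition is counted directly.
  counts₁ M m m<M zero = count-≡ (a-zero m) (count-[] 1 m)
  counts₁ M m m<M 1 = count-cong (lift 𝒟₁-join) (lift 𝒟₁-split)
    -- The blocks 2, 3 and 2, 4 already have two parts, so they contribute an empty count; the added
    -- zero makes room for it.
    (trans (a-one m) (cong (λ z → (q^ (0 + 2 * 1) ⊛ f 1) m ℤ.+ z) (sym (ℤ.+-identityʳ _))))
    (sized-⊎ disjoint-2 (count-▸ [] 2∣2 0 1 m (f 1) λ m′ eq →
      proj₁ (counts M m′ (smaller (s≤s z≤n) eq m<M) 1))
    (sized-⊎ disjoint-4 (count-▸ (2 ∷ []) 2∣4 0 0 m (f 0) λ m′ eq →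
      proj₁ (counts M m′ (smaller (s≤s z≤n) eq m<M) 0))
    (count-∅ λ { _ (inj₁ (_ , _ , refl) , () , _) ; _ (inj₂ (_ , _ , refl) , () , _) })))
  counts₁ M m m<M (suc (suc n)) = count-cong (lift 𝒟₁-join) (lift 𝒟₁-split) (a-suc² n m)
    (sized-⊎ disjoint-2 (count-▸ [] 2∣2 0 (2 + n) m (f (2 + n)) λ m′ eq →
      proj₁ (counts M m′ (smaller (s≤s z≤n) eq m<M) (2 + n)))
    (sized-⊎ disjoint-4 (count-▸ (2 ∷ []) 2∣4 0 (1 + n) m (f (1 + n)) λ m′ eq →
      proj₁ (counts M m′ (smaller (s≤s z≤n) eq m<M) (1 + n)))
    (sized-⊎ disjoint-5 (count-▸ (2 ∷ 3 ∷ []) 2∣4 1 n m (a n) λ m′ eq →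
      proj₂ (counts M m′ (smaller (s≤s z≤n) eq m<M) n))
    (count-▸ (2 ∷ 4 ∷ []) 2∣6 0 n m (f n) λ m′ eq →
      proj₁ (counts M m′ (smaller (s≤s z≤n) eq m<M) n)))))

  counts₀ : ∀ M m → m < suc M → ∀ n → Count (Sized (𝒟 0) n m) (f n m)
  counts₀ M m m<M zero    = count-≡ (f-zero m) (count-[] 0 m)
  counts₀ M m m<M (suc n) = count-cong (lift 𝒟₀-join) (lift 𝒟₀-split) (f-suc n m)
    (sized-⊎ disjoint-1
      (count-▸ (1 ∷ []) 2∣2 0 n m (f n) λ m′ eq →
      proj₁ (counts M m′ (smaller (s≤s z≤n) eq m<M) n))
      (counts₁ M m m<M (suc n)))

  counts (suc M) m m<M n = counts₀ M m m<M n , counts₁ M m m<M n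

  hasSum-weight : HasSum 𝒫 weight f
  hasSum-weight n m with πs , u , sound , complete , eq ← proj₁ (counts (suc m) m ℕ.≤-refl n) =
    πs , u ,
    All.tabulate (λ {π} π∈ → 𝒟⇒𝒫 π (proj₁ (sound π π∈))) ,
    (λ π p w → complete π (𝒫⇒𝒟 π p , weight≢0 π w)) ,
    trans eq (sym (∑-ones (λ π → weight π n m) πs
      (All.tabulate λ {π} π∈ → let _ , len , size = sound π π∈ in weighs-one {π} len size)))
    where
    weighs-one : ∀ {π n m} → length π ≡ n → sum π ≡ m → weight π n m ≡ 1ℤ
    weighs-one {π} refl refl = weight≡1 π

mainTheorem2 : ∃[ F ] (HasSum 𝒫 weight F × HasSum U term F)
mainTheorem2 = f , Recurrences.hasSum-weight f a f-zero a-zero f-suc a-one a-suc² , hasSum-term
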